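{- Let $G$ be a finite simple graph that is prime and contains no induced subgraph isomorphic to $P_5$, $\overline{P_5}$, or $C_5$. Then either $G$ is a split graph, or $G$ admits a split divide, or $\overline{G}$ admits a split divide.
   Context: $P_n$ is the path on $n$ vertices, $C_n$ the cycle on $n$ vertices, $\overline{G}$ the complement of $G$. A graph is split if its vertex set can be partitioned into a clique and a stable set. For $S\subseteq V(G)$ and $v\notin S$: $v$ is complete to $S$ if adjacent to all of $S$, anticomplete if adjacent to none, mixed on $S$ otherwise; a set is complete (anticomplete) to a disjoint set if each of its vertices is. An anticomponent of $S$ is a subset of $S$ inducing a connected component of $\overline{G}[S]$. A homogeneous set is a non-empty $S\subseteq V(G)$ such that every vertex of $V(G)\setminus S$ is complete or anticomplete to $S$; it is proper if $|S|\ge2$ and $S\neq V(G)$; $G$ is prime if it has no proper homogeneous set. A split divide of $G$ is a partition $(A,B,C,L,T)$ of $V(G)$ (where $B$ and $T$ may be empty) such that: $|A|\ge 2$, $A$ is complete to $B$ and anticomplete to $C\cup T$, and some vertex of $A$ is complete to $L$; $L$ is a non-empty clique, every vertex of $L$ is mixed on $A$, and $L$ is complete to $B\cup C$; $|C|\ge 2$, some vertex of $C$ is complete to $B$, and no vertex of $C$ is mixed on any anticomponent of $B$; $T$ is a (possibly empty) stable set and is anticomplete to $C$. -}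

module Defs where

open import Data.Nat using (ℕ; suc; _≡ᵇ_)
open import Data.Fin using (Fin; toℕ; _≟_)
open import Data.Bool using (Bool; true; false; not; _∨_; _∧_; if_then_else_)
open import Data.Product using (Σ; ∃; _×_; _,_)
open import Data.Sum using (_⊎_)
open import Relation.Nullary using (¬_)
open import Relation.Nullary.Decidable using (⌊_⌋)
open import Relation.Binary.PropositionalEquality using (_≡_; _≢_)
open import Function.Definitions using (Injective)

Adj : ℕ → Set
Adj n = Fin n → Fin n → Bool

Symmetric : ∀ {n} → Adj n → Set
Symmetric {n} E = ∀ (u v : Fin n) → E u v ≡ E v u

Irreflexive : ∀ {n} → Adj n → Set
Irreflexive {n} E = ∀ (v : Fin n) → E v v ≡ false

compl : ∀ {n} → Adj n → Adj n
compl E u v = if ⌊ u ≟ v ⌋ then false else not (E u v)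

ContainsInduced : ∀ {n k} → Adj n → Adj k → Set
ContainsInduced {n} {k} E H =
  Σ (Fin k → Fin n) λ f → Injective _≡_ _≡_ f × (∀ i j → E (f i) (f j) ≡ H i j)

P5 : Adj 5
P5 i j = (toℕ i ≡ᵇ suc (toℕ j)) ∨ (toℕ j ≡ᵇ suc (toℕ i))

C5 : Adj 5
C5 i j = P5 i j ∨ ((toℕ i ≡ᵇ 0) ∧ (toℕ j ≡ᵇ 4)) ∨ ((toℕ i ≡ᵇ 4) ∧ (toℕ j ≡ᵇ 0))

coP5 : Adj 5
coP5 = compl P5

Subset : ℕ → Set
Subset n = Fin n → Bool

_∈_ : ∀ {n} → Fin n → Subset n → Set
v ∈ S = S v ≡ true

_∉_ : ∀ {n} → Fin n → Subset n → Set
v ∉ S = S v ≡ false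

Homogeneous : ∀ {n} → Adj n → Subset n → Set
Homogeneous {n} E S =
  (∃ λ (v : Fin n) → v ∈ S) ×
  (∀ (v : Fin n) → v ∉ S →
     (∀ u → u ∈ S → E v u ≡ true) ⊎ (∀ u → u ∈ S → E v u ≡ false))

ProperHomogeneous : ∀ {n} → Adj n → Subset n → Set
ProperHomogeneous {n} E S =
  Homogeneous E S ×
  (∃ λ (u : Fin n) → ∃ λ (v : Fin n) → u ≢ v × u ∈ S × v ∈ S) ×
  (∃ λ (v : Fin n) → v ∉ S)

Prime : ∀ {n} → Adj n → Set
Prime {n} E = ¬ (∃ λ (S : Subset n) → ProperHomogeneous E S)

IsSplit : ∀ {n} → Adj n → Set
IsSplit {n} E = ∃ λ (K : Subset n) →
  (∀ u v → u ∈ K → v ∈ K → u ≢ v → E u v ≡ true) ×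
  (∀ u v → u ∉ K → v ∉ K → E u v ≡ false)

data Part : Set where
  pA pB pC pL pT : Part

-- AntiReach E p x y : y is reachable from x in the complement of G
-- restricted to the part B (x, y ∈ B); thus {y | AntiReach E p b y}
-- is the anticomponent of B containing b.
data AntiReach {n} (E : Adj n) (p : Fin n → Part) : Fin n → Fin n → Set where
  here : ∀ {x} → p x ≡ pB → AntiReach E p x x
  step : ∀ {x y z} → AntiReach E p x y → p z ≡ pB → y ≢ z → E y z ≡ false →
         AntiReach E p x z

MixedOnAnticomponent : ∀ {n} → Adj n → (Fin n → Part) → Fin n → Fin n → Set
MixedOnAnticomponent E p c b =
  ∃ λ y₁ → ∃ λ y₂ → AntiReach E p b y₁ × AntiReach E p b y₂ ×
    E c y₁ ≡ true × E c y₂ ≡ false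

IsSplitDivide : ∀ {n} → Adj n → (Fin n → Part) → Set
IsSplitDivide {n} E p =
  (∃ λ (a₁ : Fin n) → ∃ λ (a₂ : Fin n) → a₁ ≢ a₂ × p a₁ ≡ pA × p a₂ ≡ pA) ×
  (∀ a b → p a ≡ pA → p b ≡ pB → E a b ≡ true) ×
  (∀ a x → p a ≡ pA → (p x ≡ pC ⊎ p x ≡ pT) → E a x ≡ false) ×
  (∃ λ a → p a ≡ pA × (∀ l → p l ≡ pL → E a l ≡ true)) ×
  (∃ λ l → p l ≡ pL) ×
  (∀ l₁ l₂ → p l₁ ≡ pL → p l₂ ≡ pL → l₁ ≢ l₂ → E l₁ l₂ ≡ true) ×
  (∀ l → p l ≡ pL → ∃ λ a₁ → ∃ λ a₂ →
      p a₁ ≡ pA × p a₂ ≡ pA × E l a₁ ≡ true × E l a₂ ≡ false) ×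
  (∀ l x → p l ≡ pL → (p x ≡ pB ⊎ p x ≡ pC) → E l x ≡ true) ×
  (∃ λ (c₁ : Fin n) → ∃ λ (c₂ : Fin n) → c₁ ≢ c₂ × p c₁ ≡ pC × p c₂ ≡ pC) ×
  (∃ λ c → p c ≡ pC × (∀ b → p b ≡ pB → E c b ≡ true)) ×
  (∀ c b → p c ≡ pC → p b ≡ pB → ¬ MixedOnAnticomponent E p c b) ×
  (∀ t₁ t₂ → p t₁ ≡ pT → p t₂ ≡ pT → E t₁ t₂ ≡ false) ×
  (∀ t c → p t ≡ pT → p c ≡ pC → E t c ≡ false)

HasSplitDivide : ∀ {n} → Adj n → Set
HasSplitDivide {n} E = ∃ λ (p : Fin n → Part) → IsSplitDivide E p

{-# OPTIONS --safe #-}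
module Submission where

-- If G is not split, then by Földes–Hammer G or its complement contains 2K₂, say G.  Take two
-- anticomplete sets ("wings") whose union W has no isolated vertices, with W maximal.  Let the hub
-- consist of the other vertices with a neighbour in W.  The remaining vertices are stable and
-- anticomplete to W, a hub vertex mixed on one wing is complete to the other wing, and nonadjacent
-- hub vertices have the same neighbours in W.
-- If the hub is a clique, G has a split divide with the wings as A and C, and L the hub vertices
-- mixed on A.  Otherwise let D be a non-trivial anticomponent of the hub, and write D → D′ if some
-- vertex mixed on D has a neighbour in another non-trivial anticomponent D′.  This is a strict
-- partial order, so D may be chosen to be a sink; then the complement has a split divide with A = D,
-- L the vertices mixed on D, and B the vertices anticomplete to D in G.

open import Defs
open import Data.Bool using (Bool; true; false; not; if_then_else_)
import Data.Bool.Properties as Bool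
open import Data.Empty using (⊥; ⊥-elim)
open import Data.Fin using (Fin; zero; suc; _≟_)
open import Data.Fin.Patterns using (0F; 1F; 2F; 3F; 4F)
open import Data.Fin.Properties using (any?; all?)
open import Data.Maybe using (Maybe; just; nothing)
open import Data.Maybe.Properties using (just-injective; ≡-dec)
open import Data.Nat using (ℕ; zero; suc; _+_; _≤_; _<_; z≤n; s≤s)
open import Data.Nat.Properties
  using (≤-refl; ≤-trans; ≤-reflexive; +-mono-≤; +-monoʳ-≤; m≤n+m; m≤m+n;
         +-comm; +-assoc; +-cancelˡ-<; +-monoˡ-<; +-monoʳ-<; module ≤-Reasoning)
open import Data.Nat.Induction using (Acc; acc; <-wellFounded)
open import Data.Product using (∃; _×_; _,_; proj₁; proj₂)
open import Data.Sum as Sum using (_⊎_; inj₁; inj₂; [_,_])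
open import Data.Vec using ([]; _∷_; lookup)
open import Function using (_∘_)
open import Function.Definitions using (Injective)
open import Level using (Level)
open import Relation.Nullary using (¬_; Dec; yes; no; does; contradiction)
open import Relation.Nullary.Decidable
  using (_×-dec_; _⊎-dec_; _→-dec_; ¬?; from-yes; dec-true; dec-false)
open import Relation.Unary using (Decidable; _⊆_)
open import Relation.Binary.PropositionalEquality
  using (_≡_; _≢_; refl; sym; trans; cong; subst)

-- Besides making the remaining vertices stable, maximality of W is used in one form: a hub vertex
-- has a neighbour in every component of each wing. Otherwise it could move to the other wing,
-- together with the components that it does meet. Hence a property of wing vertices that holds at
-- the neighbours of a hub vertex and passes along wing edges holds on the whole wing; the forbidden
-- subgraphs appear at an edge where it would fail to pass. Primeness is what makes `L` non-empty:
-- with no vertex mixed on it, a wing or `D` would be homogeneous. The sink is chosen for the sake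
-- of `T`: a vertex complete to `D` with a neighbour mixed on `D` goes to `T`, which has to be
-- stable in the complement, and two such vertices that are nonadjacent in G would span an
-- anticomponent to which `D` has an arrow. G and its complement trade places several times, and a
-- double complement equals the original graph only pointwise; therefore a pair `E`, `F` is carried
-- along.

private variable
  a b : Level
  m : ℕ

-- Booleans and weighted counting over finite sets

bool : ∀ x → x ≡ true ⊎ x ≡ false
bool true  = inj₁ refl
bool false = inj₂ refl

true≢false : ∀ {x} → x ≡ true → x ≡ false → ⊥
true≢false refl ()

≢false⇒true : ∀ {x} → (x ≡ false → ⊥) → x ≡ true
≢false⇒true {true}  _ = refl
≢false⇒true {false} h = ⊥-elim (h refl)

≢true⇒false : ∀ {x} → (x ≡ true → ⊥) → x ≡ false
≢true⇒false {false} _ = refl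
≢true⇒false {true}  h = ⊥-elim (h refl)

does-true⇒ : {A : Set a} (d : Dec A) → does d ≡ true → A
does-true⇒ (yes x) _ = x

does-false⇒ : {A : Set a} (d : Dec A) → does d ≡ false → ¬ A
does-false⇒ (no ¬x) _ = ¬x

choose : {A : Fin m → Set a} {B : Fin m → Set b} →
         (∀ v → A v ⊎ B v) → (∀ v → A v) ⊎ ∃ B
choose {m = zero}  f = inj₁ λ ()
choose {m = suc m} f with f zero | choose (f ∘ suc)
... | inj₂ y | _            = inj₂ (zero , y)
... | inj₁ _ | inj₂ (v , y) = inj₂ (suc v , y)
... | inj₁ x | inj₁ g       = inj₁ λ { zero → x ; (suc v) → g v }

weigh : {P : Fin m → Set} → (Fin m → ℕ) → Decidable P → ℕ
weigh {m = zero}  w P? = 0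
weigh {m = suc m} w P? = (if does (P? zero) then w zero else 0) + weigh (w ∘ suc) (P? ∘ suc)

weigh-mono : {P Q : Fin m → Set} (w : Fin m → ℕ) (P? : Decidable P) (Q? : Decidable Q) →
             P ⊆ Q → weigh w P? ≤ weigh w Q?
weigh-mono {m = zero}  w P? Q? sub = z≤n
weigh-mono {m = suc m} w P? Q? sub with weigh-mono (w ∘ suc) (P? ∘ suc) (Q? ∘ suc) sub
... | ih with P? zero | Q? zero
... | yes p | yes q = +-monoʳ-≤ (w zero) ih
... | yes p | no ¬q = ⊥-elim (¬q (sub p))
... | no ¬p | yes q = ≤-trans ih (m≤n+m _ (w zero))
... | no ¬p | no ¬q = ih

weigh-insert : {P Q : Fin m → Set} (w : Fin m → ℕ) (P? : Decidable P) (Q? : Decidable Q) →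
               P ⊆ Q → ∀ {v} → Q v → ¬ P v → w v + weigh w P? ≤ weigh w Q?
weigh-insert w P? Q? sub {zero} q ¬p with P? zero | Q? zero
... | yes p | _     = ⊥-elim (¬p p)
... | no _  | no ¬q = ⊥-elim (¬q q)
... | no _  | yes _ = +-monoʳ-≤ (w zero) (weigh-mono (w ∘ suc) (P? ∘ suc) (Q? ∘ suc) sub)
weigh-insert w P? Q? sub {suc v} q ¬p
  with weigh-insert (w ∘ suc) (P? ∘ suc) (Q? ∘ suc) sub {v} q ¬p
... | ih with P? zero | Q? zero
... | yes p | no ¬q = ⊥-elim (¬q (sub p))
... | no _  | no _  = ih
... | no _  | yes _ = ≤-trans ih (m≤n+m _ (w zero))
... | yes _ | yes _ =
  ≤-trans (≤-reflexive (trans (sym (+-assoc (w (suc v)) (w zero) _))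
             (trans (cong (_+ weigh (w ∘ suc) (P? ∘ suc)) (+-comm (w (suc v)) (w zero)))
               (+-assoc (w zero) (w (suc v)) _))))
    (+-monoʳ-≤ (w zero) ih)

weigh-remove : {P Q : Fin m → Set} (w : Fin m → ℕ) (P? : Decidable P) (Q? : Decidable Q) →
               ∀ v → (∀ {u} → Q u → u ≡ v ⊎ P u) → weigh w Q? ≤ w v + weigh w P?
weigh-remove {P = P} {Q} w P? Q? zero sub =
  +-mono-≤ head (≤-trans (weigh-mono (w ∘ suc) (Q? ∘ suc) (P? ∘ suc) tail) (m≤n+m _ _))
  where
  head : (if does (Q? zero) then w zero else 0) ≤ w zero
  head with does (Q? zero)
  ... | true  = ≤-refl
  ... | false = z≤n
  tail : ∀ {u} → Q (suc u) → P (suc u)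
  tail q with sub q
  ... | inj₂ p = p
weigh-remove {P = P} {Q} w P? Q? (suc v) sub
  with weigh-remove (w ∘ suc) (P? ∘ suc) (Q? ∘ suc) v tail
  where
  tail : ∀ {u} → Q (suc u) → u ≡ v ⊎ P (suc u)
  tail q with sub q
  ... | inj₁ refl = inj₁ refl
  ... | inj₂ p    = inj₂ p
... | ih with P? zero | Q? zero
... | no ¬p | yes q = ⊥-elim ([ (λ ()) , ¬p ] (sub q))
... | no _  | no _  = ih
... | yes _ | no _  = ≤-trans ih (+-monoʳ-≤ (w (suc v)) (m≤n+m _ (w zero)))
... | yes _ | yes _ =
  ≤-trans (+-monoʳ-≤ (w zero) ih)
    (≤-reflexive (trans (sym (+-assoc (w zero) (w (suc v)) _))
             (trans (cong (_+ weigh (w ∘ suc) (P? ∘ suc)) (+-comm (w zero) (w (suc v))))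
               (+-assoc (w (suc v)) (w zero) _))))

size : {P : Fin m → Set} → Decidable P → ℕ
size = weigh (λ _ → 1)

size-< : {P Q : Fin m → Set} (P? : Decidable P) (Q? : Decidable Q) →
         P ⊆ Q → ∀ {v} → Q v → ¬ P v → size P? < size Q?
-- With unit weights, `1 + size P? ≤ size Q?` is the strict inequality by definition.
size-< = weigh-insert (λ _ → 1)

size≤ : {P : Fin m → Set} (P? : Decidable P) → size P? ≤ m
size≤ {m = zero}  P? = z≤n
size≤ {m = suc m} P? = +-mono-≤ head (size≤ (P? ∘ suc))
  where
  head : (if does (P? zero) then 1 else 0) ≤ 1
  head with does (P? zero)
  ... | true  = ≤-refl
  ... | false = z≤n

-- Complements and induced five-vertex subgraphs

compl-≡not : (H : Adj m) → ∀ {u v} → u ≢ v → compl H u v ≡ not (H u v)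
compl-≡not H {u} {v} u≢v with u ≟ v
... | yes u≡v = contradiction u≡v u≢v
... | no  _   = refl

compl-irrefl : (H : Adj m) → Irreflexive (compl H)
compl-irrefl H v with v ≟ v
... | yes _   = refl
... | no  v≢v = contradiction refl v≢v

compl-sym : (H : Adj m) → Symmetric H → Symmetric (compl H)
compl-sym H symH u v with u ≟ v | v ≟ u
... | yes _   | yes _   = refl
... | no  _   | no  _   = cong not (symH u v)
... | yes u≡v | no  v≢u = contradiction (sym u≡v) v≢u
... | no  u≢v | yes v≡u = contradiction (sym v≡u) u≢v

symmetric? : (H : Adj 5) → Dec (∀ i j → H i j ≡ H j i)
symmetric? H = all? λ i → all? λ j → H i j Bool.≟ H j i

irreflexive? : (H : Adj 5) → Dec (∀ i → H i i ≡ false)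
irreflexive? H = all? λ i → H i i Bool.≟ false

-- An adjacency-preserving and -reflecting map out of a twin-free graph is injective.
TwinFree : Adj 5 → Set
TwinFree H = ∀ i j → (∀ k → H i k ≡ H j k) → i ≡ j

twinFree? : (H : Adj 5) → Dec (TwinFree H)
twinFree? H = all? λ i → all? λ j → (all? λ k → H i k Bool.≟ H j k) →-dec (i ≟ j)

module _ {n : ℕ} (E : Adj n) (symE : Symmetric E) (irrE : Irreflexive E) where

  -- Ten pairs suffice: symmetry and irreflexivity supply the other entries of the matrix, and
  -- twin-freeness supplies injectivity.
  containsInduced : (H : Adj 5) → (∀ i j → H i j ≡ H j i) → (∀ i → H i i ≡ false) → TwinFree H →
    (v : Fin 5 → Fin n) →
    E (v 0F) (v 1F) ≡ H 0F 1F → E (v 0F) (v 2F) ≡ H 0F 2F → E (v 0F) (v 3F) ≡ H 0F 3F →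
    E (v 0F) (v 4F) ≡ H 0F 4F → E (v 1F) (v 2F) ≡ H 1F 2F → E (v 1F) (v 3F) ≡ H 1F 3F →
    E (v 1F) (v 4F) ≡ H 1F 4F → E (v 2F) (v 3F) ≡ H 2F 3F → E (v 2F) (v 4F) ≡ H 2F 4F →
    E (v 3F) (v 4F) ≡ H 3F 4F → ContainsInduced E H
  containsInduced H symH irrH twinFree v e01 e02 e03 e04 e12 e13 e14 e23 e24 e34 =
    v , injective , eq
    where
    flip : ∀ {i j} → E (v i) (v j) ≡ H i j → E (v j) (v i) ≡ H j i
    flip {i} {j} e = trans (symE (v j) (v i)) (trans e (symH i j))
    diag : ∀ i → E (v i) (v i) ≡ H i i
    diag i = trans (irrE (v i)) (sym (irrH i))
    eq : ∀ i j → E (v i) (v j) ≡ H i j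
    eq 0F 0F = diag 0F
    eq 0F 1F = e01
    eq 0F 2F = e02
    eq 0F 3F = e03
    eq 0F 4F = e04
    eq 1F 0F = flip e01
    eq 1F 1F = diag 1F
    eq 1F 2F = e12
    eq 1F 3F = e13
    eq 1F 4F = e14
    eq 2F 0F = flip e02
    eq 2F 1F = flip e12
    eq 2F 2F = diag 2F
    eq 2F 3F = e23
    eq 2F 4F = e24
    eq 3F 0F = flip e03
    eq 3F 1F = flip e13
    eq 3F 2F = flip e23
    eq 3F 3F = diag 3F
    eq 3F 4F = e34
    eq 4F 0F = flip e04
    eq 4F 1F = flip e14
    eq 4F 2F = flip e24
    eq 4F 3F = flip e34
    eq 4F 4F = diag 4F
    injective : Injective _≡_ _≡_ v
    injective {i} {j} vi≡vj = twinFree i j λ k →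
      trans (sym (eq i k)) (trans (cong (λ x → E x (v k)) vi≡vj) (eq j k))

-- PathFree E true and PathFree E false exclude P₅ and its complement, respectively.
PathFree : ∀ {n} → Adj n → Bool → Set
PathFree {n} E x = ∀ (a b c d e : Fin n) →
  E a b ≡ x → E b c ≡ x → E c d ≡ x → E d e ≡ x →
  E a c ≡ not x → E a d ≡ not x → E a e ≡ not x →
  E b d ≡ not x → E b e ≡ not x → E c e ≡ not x → ⊥

CycleFree : ∀ {n} → Adj n → Set
CycleFree {n} E = ∀ (a b c d e : Fin n) →
  E a b ≡ true → E b c ≡ true → E c d ≡ true → E d e ≡ true → E a e ≡ true →
  E a c ≡ false → E a d ≡ false → E b d ≡ false → E b e ≡ false → E c e ≡ false → ⊥

-- F is the complement of E up to pointwise equality, so that E and F play symmetric roles.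
record Complementary {n} (E F : Adj n) : Set where
  field
    symE : Symmetric E
    irrE : Irreflexive E
    symF : Symmetric F
    irrF : Irreflexive F
    opp  : ∀ {u v} → u ≢ v → F u v ≡ not (E u v)

  Fedge : ∀ {u v} → u ≢ v → E u v ≡ false → F u v ≡ true
  Fedge u≢v e = trans (opp u≢v) (cong not e)

  Fnonedge : ∀ {u v} → E u v ≡ true → F u v ≡ false
  Fnonedge {u} {v} e with u ≟ v
  ... | yes refl = irrF u
  ... | no  u≢v  = trans (opp u≢v) (cong not e)

  Eedge⇒≢ : ∀ {u v} → E u v ≡ true → u ≢ v
  Eedge⇒≢ {u} e refl = true≢false e (irrE u)

  Fedge⇒ : ∀ {u v} → F u v ≡ true → E u v ≡ false
  Fedge⇒ {u} {v} f = ≢true⇒false λ e → true≢false f (Fnonedge e)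

  Fnonedge⇒ : ∀ {u v} → u ≢ v → F u v ≡ false → E u v ≡ true
  Fnonedge⇒ u≢v f = ≢false⇒true λ e → true≢false (Fedge u≢v e) f

  E-swap : ∀ {u v x} → E u v ≡ x → E v u ≡ x
  E-swap {u} {v} = trans (symE v u)

  F-swap : ∀ {u v x} → F u v ≡ x → F v u ≡ x
  F-swap {u} {v} = trans (symF v u)

  transfer : (H : Adj 5) → ContainsInduced F H → ContainsInduced E (compl H)
  transfer H (v , inj , eq) = v , inj , eq′
    where
    eq′ : ∀ i j → E (v i) (v j) ≡ compl H i j
    eq′ i j with i ≟ j
    ... | yes refl = irrE (v i)
    ... | no  i≢j  = trans (sym (Bool.not-involutive _))
                       (cong not (trans (sym (opp (i≢j ∘ inj))) (eq i j)))

flip-complementary : ∀ {n} {E F : Adj n} → Complementary E F → Complementary F E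
flip-complementary {E = E} {F} c = record
  { symE = symF ; irrE = irrF ; symF = symE ; irrF = irrE
  ; opp = λ u≢v → trans (sym (Bool.not-involutive _)) (cong not (sym (opp u≢v))) }
  where open Complementary c

compl-complementary : ∀ {n} {E : Adj n} → Symmetric E → Irreflexive E → Complementary E (compl E)
compl-complementary {E = E} symE irrE = record
  { symE = symE ; irrE = irrE ; symF = compl-sym E symE ; irrF = compl-irrefl E
  ; opp = compl-≡not E }

record Admissible {n} (E F : Adj n) : Set where
  field
    complementary : Complementary E F
    prime         : Prime E
    noP5          : ¬ ContainsInduced E P5
    noCoP5        : ¬ ContainsInduced E coP5
    noC5          : ¬ ContainsInduced E C5

  open Complementary complementary public

  private
    five : (a b c d e : Fin n) → Fin 5 → Fin n
    five a b c d e = lookup (a ∷ b ∷ c ∷ d ∷ e ∷ [])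

  pathFree : PathFree E true
  pathFree a b c d e ab bc cd de ac ad ae bd be ce =
    noP5 (containsInduced E symE irrE P5 (from-yes (symmetric? P5)) (from-yes (irreflexive? P5))
      (from-yes (twinFree? P5)) (five a b c d e) ab ac ad ae bc bd be cd ce de)

  houseFree : PathFree E false
  houseFree a b c d e ab bc cd de ac ad ae bd be ce =
    noCoP5 (containsInduced E symE irrE coP5 (from-yes (symmetric? coP5))
      (from-yes (irreflexive? coP5)) (from-yes (twinFree? coP5))
      (five a b c d e) ab ac ad ae bc bd be cd ce de)

  cycleFree : CycleFree E
  cycleFree a b c d e ab bc cd de ae ac ad bd be ce =
    noC5 (containsInduced E symE irrE C5 (from-yes (symmetric? C5)) (from-yes (irreflexive? C5))
      (from-yes (twinFree? C5)) (five a b c d e) ab ac ad ae bc bd be cd ce de)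

-- i ↦ 2 i mod 5 maps C₅ isomorphically onto its complement.
relabel-C5 : ∀ {n} {E : Adj n} → ContainsInduced E (compl C5) → ContainsInduced E C5
relabel-C5 {E = E} (v , inj , eq) =
  v ∘ double , double-inj _ _ ∘ inj , λ i j → trans (eq (double i) (double j)) (double-hom i j)
  where
  double : Fin 5 → Fin 5
  double = lookup (0F ∷ 2F ∷ 4F ∷ 1F ∷ 3F ∷ [])
  double-inj : ∀ i j → double i ≡ double j → i ≡ j
  double-inj = from-yes (all? λ i → all? λ j → (double i ≟ double j) →-dec (i ≟ j))
  double-hom : ∀ i j → compl C5 (double i) (double j) ≡ C5 i j
  double-hom = from-yes (all? λ i → all? λ j → compl C5 (double i) (double j) Bool.≟ C5 i j)

-- The assumptions are self-dual: P₅ and its complement change places, C₅ is self-complementary, and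
-- homogeneous sets are the same in both graphs.
flip-free : ∀ {n} {E F : Adj n} → Admissible E F → Admissible F E
flip-free {n} {E} {F} free = record
  { complementary = flip-complementary complementary
  ; prime  = prime ∘ homogeneous
  ; noP5   = noCoP5 ∘ transfer P5
  ; noCoP5 = λ i → noP5 (reindex (transfer coP5 i))
  ; noC5   = noC5 ∘ relabel-C5 {E = E} ∘ transfer C5 }
  where
  open Admissible free
  reindex : ContainsInduced E (compl coP5) → ContainsInduced E P5
  reindex (v , inj , eq) = v , inj , λ i j → trans (eq i j) (double-compl i j)
    where
    double-compl : ∀ i j → compl coP5 i j ≡ P5 i j
    double-compl = from-yes (all? λ i → all? λ j → compl coP5 i j Bool.≟ P5 i j)
  homogeneous : (∃ λ S → ProperHomogeneous F S) → ∃ λ S → ProperHomogeneous E S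
  homogeneous (S , (nonempty , uniform) , rest) = S , (nonempty , uniform′) , rest
    where
    ≢ : ∀ {u v} → v ∉ S → u ∈ S → v ≢ u
    ≢ v∉S u∈S refl = true≢false u∈S v∉S
    uniform′ : ∀ v → v ∉ S →
      (∀ u → u ∈ S → E v u ≡ true) ⊎ (∀ u → u ∈ S → E v u ≡ false)
    uniform′ v v∉S with uniform v v∉S
    ... | inj₁ h = inj₂ λ u u∈S → Fedge⇒ (h u u∈S)
    ... | inj₂ h = inj₁ λ u u∈S → Fnonedge⇒ (≢ v∉S u∈S) (h u u∈S)

-- Unions of components and a common neighbour for a clique

Closed : ∀ {n} → Adj n → (Fin n → Set) → (Fin n → Set) → Set
Closed E X Y = ∀ {u v} → X u → X v → Y u → E u v ≡ true → Y v

-- The union of the components of E[X] that meet I.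
record Closure {n} (E : Adj n) (X I : Fin n → Set) : Set₁ where
  field
    Z      : Fin n → Set
    Z?     : Decidable Z
    Z⊆X    : Z ⊆ X
    seed   : ∀ {v} → X v → I v → Z v
    closed : Closed E X Z
    least  : (Y : Fin n → Set) → (∀ {v} → X v → I v → Y v) → Closed E X Y → Z ⊆ Y

closure : ∀ {n} (E : Adj n) {X I : Fin n → Set} → Decidable X → Decidable I → Closure E X I
closure {n} E {X} {I} X? I? =
  grow (λ v → X? v ×-dec I? v) proj₁ _,_ (λ Y seed _ (x , i) → seed x i) (<-wellFounded _)
  where
  grow : {Z : Fin n → Set} (Z? : Decidable Z) → Z ⊆ X → (∀ {v} → X v → I v → Z v) →
         ((Y : Fin n → Set) → (∀ {v} → X v → I v → Y v) → Closed E X Y → Z ⊆ Y) →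
         Acc _<_ (size (λ v → ¬? (Z? v))) → Closure E X I
  grow {Z} Z? Z⊆X seed least (acc rec)
    with any? (λ v → X? v ×-dec ¬? (Z? v) ×-dec any? (λ u → Z? u ×-dec (E u v Bool.≟ true)))
  ... | no none = record
    { Z = Z ; Z? = Z? ; Z⊆X = Z⊆X ; seed = seed ; least = least
    ; closed = closed }
    where
    closed : Closed E X Z
    closed {u} {v} _ xv zu uv with Z? v
    ... | yes zv = zv
    ... | no ¬zv = ⊥-elim (none (v , xv , ¬zv , u , zu , uv))
  ... | yes (v , xv , ¬zv , u , zu , uv) =
    grow {λ x → x ≡ v ⊎ Z x} (λ x → (x ≟ v) ⊎-dec Z? x)
      [ (λ { refl → xv }) , Z⊆X ] (λ x i → inj₂ (seed x i))
      (λ Y s c → [ (λ { refl → c (Z⊆X zu) xv (least Y s c zu) uv }) , least Y s c ])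
      (rec (size-< (λ x → ¬? ((x ≟ v) ⊎-dec Z? x)) (λ x → ¬? (Z? x)) (_∘ inj₂) ¬zv
              (λ h → h (inj₁ refl))))

-- Every component of E[X] contains a neighbour of s.
Meets : ∀ {n} → Adj n → (Fin n → Set) → Fin n → Set₁
Meets {n} E X s = (Y : Fin n → Set) → (∀ {v} → X v → E s v ≡ true → Y v) → Closed E X Y → X ⊆ Y

module _ {n} {E : Adj n} (symE : Symmetric E)
         (pathFree : PathFree E true) (houseFree : PathFree E false) where

  -- Descent on the set of vertices of `R` that `x` misses. If `x` misses `u`, then, paths starting
  -- with `y`, `u` being excluded, some `p` in `X` is adjacent to both `u` and `x`. Passing to `p`
  -- gains `u` and loses no `v`, since otherwise `u`, `x`, `y`, `p`, `v` would induce a house. Both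
  -- divides use this, one in G for the wings, the other in the complement for `D`.
  common-neighbour : {X R : Fin n → Set} → Decidable X → Decidable R → (y : Fin n) →
    (∀ {x} → X x → E y x ≡ false) → (∀ {u} → R u → E y u ≡ true) →
    (∀ {u v} → R u → R v → u ≢ v → E u v ≡ true) → (∀ {u} → R u → Meets E X u) →
    ∃ X → ∃ λ x → X x × (∀ {u} → R u → E x u ≡ true)
  common-neighbour {X} {R} X? R? y yX yR clique meets (x₀ , Xx₀) =
    improve x₀ Xx₀ (<-wellFounded _)
    where
    swap : ∀ {u v b} → E u v ≡ b → E v u ≡ b
    swap {u} {v} = trans (symE v u)
    missing? : ∀ x → Decidable (λ u → R u × E x u ≡ false)
    missing? x u = R? u ×-dec (E x u Bool.≟ false)
    Near : Fin n → Fin n → Set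
    Near u z = E u z ≡ true ⊎ ∃ λ p → X p × E u p ≡ true × E p z ≡ true
    near-closed : ∀ {u} → R u → Closed E X (Near u)
    near-closed ru {z₁} {z₂} x₁ x₂ (inj₁ uz₁) z₁z₂ = inj₂ (z₁ , x₁ , uz₁ , z₁z₂)
    near-closed {u} ru {z₁} {z₂} x₁ x₂ (inj₂ (p , xp , up , pz₁)) z₁z₂
      with bool (E u z₁) | bool (E u z₂) | bool (E p z₂)
    ... | inj₁ uz₁ | _        | _        = inj₂ (z₁ , x₁ , uz₁ , z₁z₂)
    ... | _        | inj₁ uz₂ | _        = inj₁ uz₂
    ... | _        | _        | inj₁ pz₂ = inj₂ (p , xp , up , pz₂)
    ... | inj₂ uz₁ | inj₂ uz₂ | inj₂ pz₂ =
      ⊥-elim (pathFree y u p z₁ z₂ (yR ru) up pz₁ z₁z₂ (yX xp) (yX x₁) (yX x₂) uz₁ uz₂ pz₂)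
    improve : ∀ x → X x → Acc _<_ (size (missing? x)) → ∃ λ x → X x × (∀ {u} → R u → E x u ≡ true)
    improve x xx (acc rec) with any? (missing? x)
    ... | no none = x , xx , λ ru → ≢false⇒true λ e → none (_ , ru , e)
    ... | yes (u , ru , xu) with meets ru (Near u) (λ _ → inj₁) (near-closed ru) xx
    ...   | inj₁ ux = ⊥-elim (true≢false (swap ux) xu)
    ...   | inj₂ (p , xp , up , px) =
      improve p xp (rec (size-< (missing? p) (missing? x) keep (ru , xu)
        λ (_ , pu) → true≢false (swap up) pu))
      where
      keep : ∀ {v} → R v × E p v ≡ false → R v × E x v ≡ false
      keep {v} (rv , pv) = rv , ≢true⇒false λ xv →
        houseFree u x y p v (swap xu) (swap (yX xx)) (yX xp) pv (swap (yR ru)) up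
          (clique ru rv λ { refl → true≢false xv xu }) (swap px) xv (yR rv)

-- Separations and their enlargement to a frame

-- Two non-empty anticomplete sets, the vertices labelled just true and just false, whose
-- union induces a graph without isolated vertices.
record Separation {n} (E : Adj n) (label : Fin n → Maybe Bool) : Set where
  field
    point : ∀ b → ∃ λ v → label v ≡ just b
    edge  : ∀ {b v} → label v ≡ just b → ∃ λ w → label w ≡ just b × E v w ≡ true
    anti  : ∀ {b v w} → label v ≡ just b → label w ≡ just (not b) → E v w ≡ false

data Kind : Set where
  wing     : Bool → Kind
  hub free : Kind

wing-injective : ∀ {b c} → wing b ≡ wing c → b ≡ c
wing-injective refl = refl

_≟ᴷ_ : (k l : Kind) → Dec (k ≡ l)
wing b ≟ᴷ wing c with b Bool.≟ c
... | yes refl = yes refl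
... | no  b≢c  = no (b≢c ∘ wing-injective)
hub    ≟ᴷ hub    = yes refl
free   ≟ᴷ free   = yes refl
wing _ ≟ᴷ hub    = no λ ()
wing _ ≟ᴷ free   = no λ ()
hub    ≟ᴷ wing _ = no λ ()
hub    ≟ᴷ free   = no λ ()
free   ≟ᴷ wing _ = no λ ()
free   ≟ᴷ hub    = no λ ()

-- The shape of a separation whose union is maximal: the hub consists of the other vertices
-- with a neighbour in the union.
record Frame {n} (E : Adj n) : Set₁ where
  field
    kind        : Fin n → Kind
    wing-point  : ∀ b → ∃ λ v → kind v ≡ wing b
    wing-edge   : ∀ {b v} → kind v ≡ wing b → ∃ λ w → kind w ≡ wing b × E v w ≡ true
    wing-anti   : ∀ {b v w} → kind v ≡ wing b → kind w ≡ wing (not b) → E v w ≡ false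
    free-wing   : ∀ {b v w} → kind v ≡ free → kind w ≡ wing b → E v w ≡ false
    free-stable : ∀ {v w} → kind v ≡ free → kind w ≡ free → E v w ≡ false
    hub-meets   : ∀ {s} b → kind s ≡ hub → Meets E (λ v → kind v ≡ wing b) s

just≢nothing : ∀ {x : Maybe Bool} {b} → x ≡ just b → x ≡ nothing → ⊥
just≢nothing refl ()

module _ {n} {E : Adj n} (symE : Symmetric E) (irrE : Irreflexive E) where

  private
    swap : ∀ {u v b} → E u v ≡ b → E v u ≡ b
    swap {u} {v} = trans (symE v u)

    relabel : {M : Fin n → Set} → Decidable M → Bool → (Fin n → Maybe Bool) → Fin n → Maybe Bool
    relabel M? b label v = if does (M? v) then just b else label v

    relabel-in : {M : Fin n → Set} (M? : Decidable M) (b : Bool) (label : Fin n → Maybe Bool) →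
                 ∀ {v} → M v → relabel M? b label v ≡ just b
    relabel-in M? b label {v} mv with M? v
    ... | yes _  = refl
    ... | no ¬mv = ⊥-elim (¬mv mv)

    relabel-out : {M : Fin n → Set} (M? : Decidable M) (b : Bool) (label : Fin n → Maybe Bool) →
                  ∀ {v} → ¬ M v → relabel M? b label v ≡ label v
    relabel-out M? b label {v} ¬mv with M? v
    ... | yes mv = ⊥-elim (¬mv mv)
    ... | no _   = refl

    relabel-inv : {M : Fin n → Set} (M? : Decidable M) (b : Bool) (label : Fin n → Maybe Bool) →
                  ∀ {v c} → relabel M? b label v ≡ just c →
                  (M v × c ≡ b) ⊎ (¬ M v × label v ≡ just c)
    relabel-inv M? b label {v} eq with M? v
    ... | yes mv = inj₁ (mv , sym (just-injective eq))
    ... | no ¬mv = inj₂ (¬mv , eq)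

    unlabelled? : (label : Fin n → Maybe Bool) → Decidable (λ v → label v ≡ nothing)
    unlabelled? label v = ≡-dec Bool._≟_ (label v) nothing

    relabel-size : {M : Fin n → Set} (M? : Decidable M) (b : Bool) (label : Fin n → Maybe Bool) →
                   ∀ {v} → M v → label v ≡ nothing →
                   size (unlabelled? (relabel M? b label)) < size (unlabelled? label)
    relabel-size {M} M? b label {v} mv none =
      size-< (unlabelled? (relabel M? b label)) (unlabelled? label) sub none
        (just≢nothing (relabel-in M? b label mv))
      where
      sub : ∀ {u} → relabel M? b label u ≡ nothing → label u ≡ nothing
      sub {u} eq with M? u
      ... | no _ = eq

  -- The enlargement whose failure makes the free vertices of a frame stable.
  add-edge : (label : Fin n → Maybe Bool) → Separation E label → ∀ {t t′} →
    (∀ {v b} → label v ≡ just b → E t v ≡ false) → (∀ {v b} → label v ≡ just b → E t′ v ≡ false) →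
    label t ≡ nothing → E t t′ ≡ true →
    ∃ λ label′ → Separation E label′ × size (unlabelled? label′) < size (unlabelled? label)
  add-edge label sep {t} {t′} anti-t anti-t′ none tt′ =
    relabel M? true label , sep′ , relabel-size M? true label (inj₁ refl) none
    where
    open Separation sep
    M : Fin n → Set
    M v = v ≡ t ⊎ v ≡ t′
    M? : Decidable M
    M? v = (v ≟ t) ⊎-dec (v ≟ t′)
    fresh : ∀ {v b} → label v ≡ just b → ¬ M v
    fresh lv (inj₁ refl) = just≢nothing lv none
    -- A labelled `t′` would be a labelled neighbour of `t`.
    fresh lv (inj₂ refl) = true≢false tt′ (anti-t lv)
    new : ∀ {v} → M v → relabel M? true label v ≡ just true
    new = relabel-in M? true label
    old : ∀ {v b} → label v ≡ just b → relabel M? true label v ≡ just b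
    old lv = trans (relabel-out M? true label (fresh lv)) lv
    M-anti : ∀ {v w b} → M v → label w ≡ just b → E v w ≡ false
    M-anti (inj₁ refl) = anti-t
    M-anti (inj₂ refl) = anti-t′
    sep′ : Separation E (relabel M? true label)
    sep′ = record { point = λ b → let v , lv = point b in v , old lv
                  ; edge = edge′ ; anti = anti′ }
      where
      edge′ : ∀ {b v} → relabel M? true label v ≡ just b →
              ∃ λ w → relabel M? true label w ≡ just b × E v w ≡ true
      edge′ eq with relabel-inv M? true label eq
      ... | inj₁ (inj₁ refl , refl) = t′ , new (inj₂ refl) , tt′
      ... | inj₁ (inj₂ refl , refl) = t , new (inj₁ refl) , swap tt′
      ... | inj₂ (_ , lv) = let w , lw , vw = edge lv in w , old lw , vw
      anti′ : ∀ {b v w} → relabel M? true label v ≡ just b → relabel M? true label w ≡ just (not b) →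
              E v w ≡ false
      anti′ eq eq′ with relabel-inv M? true label eq | relabel-inv M? true label eq′
      ... | inj₁ (mv , _)    | inj₂ (_ , lw)    = M-anti mv lw
      ... | inj₂ (_ , lv)    | inj₁ (mw , _)    = swap (M-anti mw lv)
      ... | inj₂ (_ , lv)    | inj₂ (_ , lw)    = anti lv lw
      ... | inj₁ (_ , refl)  | inj₁ (_ , ())

  -- If s misses the part X ∖ Z of the wing X = label⁻¹ (just b), where Z is the union of the
  -- components of E[X] that s meets, then Z ∪ {s} can be moved to the other wing.
  absorb : (label : Fin n → Maybe Bool) → Separation E label → ∀ {s w c} b →
    label s ≡ nothing → label w ≡ just c → E s w ≡ true →
    (cl : Closure E (λ v → label v ≡ just b) (λ v → E s v ≡ true)) →
    (∃ λ x → label x ≡ just b × ¬ Closure.Z cl x) →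
    ∃ λ label′ → Separation E label′ × size (unlabelled? label′) < size (unlabelled? label)
  absorb label sep {s} {w₀} {c₀} b none lw₀ sw₀ cl (x₀ , lx₀ , ¬zx₀) =
    relabel M? (not b) label , sep′ , relabel-size M? (not b) label (inj₁ refl) none
    where
    open Separation sep
    open Closure cl
    M : Fin n → Set
    M v = v ≡ s ⊎ Z v
    M? : Decidable M
    M? v = (v ≟ s) ⊎-dec Z? v
    new : ∀ {v} → M v → relabel M? (not b) label v ≡ just (not b)
    new = relabel-in M? (not b) label
    old : ∀ {v c} → ¬ M v → label v ≡ just c → relabel M? (not b) label v ≡ just c
    old ¬mv lv = trans (relabel-out M? (not b) label ¬mv) lv
    s-fresh : ∀ {v c} → label v ≡ just c → v ≢ s
    s-fresh lv refl = just≢nothing lv none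
    other-fresh : ∀ {v} → label v ≡ just (not b) → ¬ M v
    other-fresh lv (inj₁ refl) = just≢nothing lv none
    other-fresh lv (inj₂ zv)   = Bool.not-¬ refl (just-injective (trans (sym (Z⊆X zv)) lv))
    M-anti : ∀ {v w} → M v → ¬ M w → label w ≡ just b → E v w ≡ false
    M-anti (inj₁ refl) ¬mw lw = ≢true⇒false λ sw → ¬mw (inj₂ (seed lw sw))
    M-anti (inj₂ zv)   ¬mw lw = ≢true⇒false λ vw → ¬mw (inj₂ (closed (Z⊆X zv) lw zv vw))
    sep′ : Separation E (relabel M? (not b) label)
    sep′ = record { point = point′ ; edge = edge′ ; anti = anti′ }
      where
      point′ : ∀ c → ∃ λ v → relabel M? (not b) label v ≡ just c
      point′ c with c Bool.≟ b
      -- `x₀` stays behind, so the wing that loses `Z` is not emptied.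
      ... | yes refl = x₀ , old [ s-fresh lx₀ , ¬zx₀ ] lx₀
      ... | no  c≢b  = s , trans (new (inj₁ refl)) (cong just (sym (Bool.¬-not c≢b)))
      edge′ : ∀ {c v} → relabel M? (not b) label v ≡ just c →
              ∃ λ w → relabel M? (not b) label w ≡ just c × E v w ≡ true
      edge′ {c} {v} eq with relabel-inv M? (not b) label eq
      ... | inj₁ (inj₂ zv , refl) =
        let w , lw , vw = edge (Z⊆X zv) in w , new (inj₂ (closed (Z⊆X zv) lw zv vw)) , vw
      ... | inj₂ (¬mv , lv) = let w , lw , vw = edge lv in w , old (λ mw → stay lw vw mw) lw , vw
        where
        stay : ∀ {w} → label w ≡ just c → E v w ≡ true → ¬ M w
        stay lw vw (inj₁ refl) = just≢nothing lw none
        stay lw vw (inj₂ zw) with just-injective (trans (sym (Z⊆X zw)) lw)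
        ... | refl = ¬mv (inj₂ (closed lw lv zw (swap vw)))
      -- The vertex `s` needs a neighbour in its new wing: `w₀` either moves along as a member of
      -- `Z` or lies there already.
      ... | inj₁ (inj₁ refl , refl) with c₀ Bool.≟ b
      ...   | yes refl = w₀ , new (inj₂ (seed lw₀ sw₀)) , sw₀
      ...   | no  c≢b with Bool.¬-not c≢b
      ...     | refl = w₀ , old (other-fresh lw₀) lw₀ , sw₀
      anti′ : ∀ {c v w} → relabel M? (not b) label v ≡ just c →
              relabel M? (not b) label w ≡ just (not c) → E v w ≡ false
      anti′ {c} eq eq′ with relabel-inv M? (not b) label eq | relabel-inv M? (not b) label eq′
      ... | inj₁ (mv , refl) | inj₂ (¬mw , lw) =
        M-anti mv ¬mw (trans lw (cong just (Bool.not-involutive b)))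
      ... | inj₂ (¬mv , lv) | inj₁ (mw , e) =
        swap (M-anti mw ¬mv (trans lv (cong just (Bool.not-injective e))))
      ... | inj₂ (_ , lv) | inj₂ (_ , lw) = anti lv lw
      ... | inj₁ (_ , e) | inj₁ (_ , e′) = ⊥-elim (Bool.not-¬ refl (trans e (sym e′)))

  -- Each use of `add-edge` or `absorb` labels a new vertex, so the process ends; when neither
  -- applies, `free-stable` and `hub-meets` hold.
  frame : (label : Fin n → Maybe Bool) → Separation E label → Frame E
  frame label sep = extend label sep (<-wellFounded _)
    where
    Touches : (Fin n → Maybe Bool) → Fin n → Set
    Touches label v = ∃ λ w → (∃ λ b → label w ≡ just b) × E v w ≡ true
    labelled? : (label : Fin n → Maybe Bool) (w : Fin n) → Dec (∃ λ b → label w ≡ just b)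
    labelled? label w with label w
    ... | just b  = yes (b , refl)
    ... | nothing = no λ { (_ , ()) }
    touches? : ∀ label → Decidable (Touches label)
    touches? label v = any? λ w → labelled? label w ×-dec (E v w Bool.≟ true)
    Free : (Fin n → Maybe Bool) → Fin n → Set
    Free label v = label v ≡ nothing × ¬ Touches label v
    free? : ∀ label → Decidable (Free label)
    free? label v = unlabelled? label v ×-dec ¬? (touches? label v)
    untouched : ∀ label {t} → Free label t → ∀ {v b} → label v ≡ just b → E t v ≡ false
    untouched label (_ , ¬tt) {v} lv = ≢true⇒false λ tv → ¬tt (v , (_ , lv) , tv)
    Hub : (Fin n → Maybe Bool) → Fin n → Set
    Hub label v = label v ≡ nothing × Touches label v
    kindOf : ∀ label → Fin n → Kind
    kindOf label v with label v | does (touches? label v)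
    ... | just b  | _     = wing b
    ... | nothing | true  = hub
    ... | nothing | false = free
    wing-of : ∀ (label : Fin n → Maybe Bool) {v b} → label v ≡ just b → kindOf label v ≡ wing b
    wing-of label {v} eq with label v | does (touches? label v)
    wing-of label refl | just b | _ = refl
    is-wing : ∀ label {v b} → kindOf label v ≡ wing b → label v ≡ just b
    is-wing label {v} eq with label v | does (touches? label v)
    is-wing label refl | just b  | _     = refl
    is-wing label ()   | nothing | true
    is-wing label ()   | nothing | false
    is-hub : ∀ label {v} → kindOf label v ≡ hub → Hub label v
    is-hub label {v} eq with label v | touches? label v
    is-hub label eq | nothing | yes t = refl , t
    is-free : ∀ label {v} → kindOf label v ≡ free → Free label v
    is-free label {v} eq with label v | touches? label v
    is-free label eq | nothing | no ¬t = refl , ¬t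

    Improvement : (Fin n → Maybe Bool) → Set
    Improvement label =
      ∃ λ label′ → Separation E label′ × size (unlabelled? label′) < size (unlabelled? label)

    hub-step : ∀ label → Separation E label → ∀ b s →
      (Hub label s → Meets E (λ v → label v ≡ just b) s) ⊎ Improvement label
    hub-step label sep b s with unlabelled? label s ×-dec touches? label s
    ... | no ¬h = inj₁ λ h → ⊥-elim (¬h h)
    ... | yes (none , w , (_ , lw) , sw)
      with closure E {λ v → label v ≡ just b} {λ v → E s v ≡ true}
             (λ v → ≡-dec Bool._≟_ (label v) (just b)) (λ v → E s v Bool.≟ true)
    ...   | cl with any? (λ v → ≡-dec Bool._≟_ (label v) (just b) ×-dec ¬? (Closure.Z? cl v))
    ...     | yes x = inj₂ (absorb label sep b none lw sw cl x)
    ...     | no ¬x = inj₁ λ _ Y seed closed {v} lv → Closure.least cl Y seed closed (all-Z lv)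
      where
      all-Z : ∀ {v} → label v ≡ just b → Closure.Z cl v
      all-Z {v} lv with Closure.Z? cl v
      ... | yes z = z
      ... | no ¬z = ⊥-elim (¬x (v , lv , ¬z))

    extend : ∀ label → Separation E label → Acc _<_ (size (unlabelled? label)) → Frame E
    extend label sep (acc rec)
      with any? (λ t → any? λ t′ → free? label t ×-dec free? label t′ ×-dec (E t t′ Bool.≟ true))
    ... | yes (t , t′ , ft , ft′ , tt′) =
      let label′ , sep′ , smaller =
            add-edge label sep (untouched label ft) (untouched label ft′) (proj₁ ft) tt′
      in extend label′ sep′ (rec smaller)
    ... | no stable with choose (hub-step label sep true) | choose (hub-step label sep false)
    ...   | inj₂ (_ , label′ , sep′ , smaller) | _ = extend label′ sep′ (rec smaller)
    ...   | inj₁ _ | inj₂ (_ , label′ , sep′ , smaller) = extend label′ sep′ (rec smaller)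
    ...   | inj₁ meets-true | inj₁ meets-false = record
      { kind = kindOf label
      ; wing-point = λ b → let v , lv = point b in v , wing-of label lv
      ; wing-edge = λ k → let w , lw , vw = edge (is-wing label k) in w , wing-of label lw , vw
      ; wing-anti = λ kv kw → anti (is-wing label kv) (is-wing label kw)
      ; free-wing = λ kv kw → untouched label (is-free label kv) (is-wing label kw)
      ; free-stable = λ kv kw → ≢true⇒false λ vw →
          stable (_ , _ , is-free label kv , is-free label kw , vw)
      ; hub-meets = λ b ks Y seed closed kv →
          meets b _ (is-hub label ks) Y (λ lv → seed (wing-of label lv))
            (λ lu lv → closed (wing-of label lu) (wing-of label lv)) (is-wing label kv) }
      where
      open Separation sep
      meets : ∀ b s → Hub label s → Meets E (λ v → label v ≡ just b) s
      meets true  = meets-true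
      meets false = meets-false

-- Adjacency between the hub and the wings

module _ {n} {E F : Adj n} (free-EF : Admissible E F) (frame-E : Frame E) where
  open Admissible free-EF
  open Frame frame-E

  private
    pathFree-F : PathFree F true
    pathFree-F = Admissible.pathFree (flip-free free-EF)

    houseFree-F : PathFree F false
    houseFree-F = Admissible.houseFree (flip-free free-EF)

    anti-not : ∀ {b v w} → kind v ≡ wing (not b) → kind w ≡ wing b → E v w ≡ false
    anti-not kv kw = E-swap (wing-anti kw kv)

    in-wing? : ∀ b → Decidable (λ v → kind v ≡ wing b)
    in-wing? b v = kind v ≟ᴷ wing b

  -- Otherwise the empty set could be taken for `Y` in `Meets`, and the wing would be empty.
  hub-touches : ∀ {s} → kind s ≡ hub → ∀ b → ∃ λ x → kind x ≡ wing b × E s x ≡ true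
  hub-touches {s} ks b with any? (λ x → in-wing? b x ×-dec (E s x Bool.≟ true))
  ... | yes t = t
  ... | no ¬t = ⊥-elim
    (hub-meets b ks (λ _ → ⊥) (λ kx sx → ¬t (_ , kx , sx)) (λ _ _ ()) (proj₂ (wing-point b)))

  -- Without such an edge the neighbourhood of `s` would be closed under wing edges, hence contain
  -- the whole wing by `hub-meets`.
  mixed-edge : ∀ {s b x} → kind s ≡ hub → kind x ≡ wing b → E s x ≡ false →
    ∃ λ z → ∃ λ z′ → kind z ≡ wing b × kind z′ ≡ wing b × E z z′ ≡ true ×
      E s z ≡ true × E s z′ ≡ false
  mixed-edge {s} {b} ks kx sx
    with any? (λ z → any? λ z′ → in-wing? b z ×-dec in-wing? b z′ ×-dec (E z z′ Bool.≟ true)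
                 ×-dec (E s z Bool.≟ true) ×-dec (E s z′ Bool.≟ false))
  ... | yes e = e
  ... | no ¬e = ⊥-elim (true≢false
    (hub-meets b ks (λ v → E s v ≡ true) (λ _ e → e)
      (λ kz kz′ sz zz′ → ≢false⇒true λ sz′ → ¬e (_ , _ , kz , kz′ , zz′ , sz , sz′)) kx)
    sx)

  -- If `s` missed a vertex of each wing, the two edges given by `mixed-edge` would form an induced
  -- P₅ with `s` in the middle.
  mixed⇒complete : ∀ {s b x y} → kind s ≡ hub → kind x ≡ wing b → E s x ≡ false →
    kind y ≡ wing (not b) → E s y ≡ true
  mixed⇒complete {s} ks kx sx ky = ≢false⇒true λ sy →
    let z , z′ , kz , kz′ , zz′ , sz , sz′ = mixed-edge ks kx sx
        w , w′ , kw , kw′ , ww′ , sw , sw′ = mixed-edge ks ky sy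
    in pathFree z′ z s w w′ (E-swap zz′) (E-swap sz) sw ww′ (E-swap sz′) (wing-anti kz′ kw)
         (wing-anti kz′ kw′) (wing-anti kz kw) (wing-anti kz kw′) sw′

  -- It suffices that no wing edge enters N(v) ∖ N(u) from outside: this set avoids N(u), so
  -- `hub-meets` for `u` then makes it empty. Since `u` misses `x`, it is complete to the other wing
  -- and shares a neighbour `y` there with `v`; an entering edge `z`, `z′` yields with `u`, `v`, `y`
  -- a house, a C₅ or a P₅, according to the adjacencies of `z`.
  nonadjacent-hubs : ∀ {u v b x} → kind u ≡ hub → kind v ≡ hub → E u v ≡ false →
    kind x ≡ wing b → E v x ≡ true → E u x ≡ true
  nonadjacent-hubs {u} {v} {b} {x} ku kv uv kx vx = ≢false⇒true λ ux →
    hub-meets b ku Common (λ _ uz (_ , uz′) → true≢false uz uz′) (closed ux) kx (vx , ux)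
    where
    Common : Fin n → Set
    Common z = ¬ (E v z ≡ true × E u z ≡ false)
    closed : E u x ≡ false → Closed E (λ z → kind z ≡ wing b) Common
    closed ux {z} {z′} kz kz′ cz zz′ (vz′ , uz′)
      with y , ky , vy ← hub-touches kv (not b) | bool (E u z) | bool (E v z)
    ... | inj₁ uz | inj₁ vz =
      houseFree v u z′ y z (E-swap uv) uz′ (wing-anti kz′ ky) (anti-not ky kz)
        vz′ vy vz (mixed⇒complete ku kx ux ky) uz (E-swap zz′)
    ... | inj₁ uz | inj₂ vz =
      cycleFree u z z′ v y uz zz′ (E-swap vz′) vy (mixed⇒complete ku kx ux ky)
        uz′ uv (E-swap vz) (wing-anti kz ky) (wing-anti kz′ ky)
    ... | inj₂ uz | inj₁ vz = cz (vz , uz)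
    ... | inj₂ uz | inj₂ vz =
      pathFree z z′ v y u zz′ (E-swap vz′) vy (E-swap (mixed⇒complete ku kx ux ky))
        (E-swap vz) (wing-anti kz ky) (E-swap uz) (wing-anti kz′ ky) (E-swap uz′) (E-swap uv)

  -- The divide of G when the hub is a clique

  module CliqueHub (clique : ∀ {u v} → kind u ≡ hub → kind v ≡ hub → u ≢ v → E u v ≡ true) where

    private
      A C : Fin n → Set
      A v = kind v ≡ wing true
      C v = kind v ≡ wing false

    -- For hub vertices a single non-neighbour in `A` means mixed, by `hub-touches`.
    Mixed : Fin n → Set
    Mixed s = ∃ λ x → A x × E s x ≡ false

    mixed? : Decidable Mixed
    mixed? s = any? λ x → in-wing? true x ×-dec (E s x Bool.≟ false)

    partOf : Kind → Bool → Part
    partOf (wing true)  _     = pA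
    partOf (wing false) _     = pC
    partOf hub          true  = pL
    partOf hub          false = pB
    partOf free         _     = pT

    part : Fin n → Part
    part v = partOf (kind v) (does (mixed? v))

    partOf-A : ∀ k m → partOf k m ≡ pA → k ≡ wing true
    partOf-A (wing true) _ _ = refl
    partOf-A hub true ()
    partOf-A hub false ()

    partOf-C : ∀ k m → partOf k m ≡ pC → k ≡ wing false
    partOf-C (wing false) _ _ = refl
    partOf-C hub true ()
    partOf-C hub false ()

    partOf-T : ∀ k m → partOf k m ≡ pT → k ≡ free
    partOf-T free _ _ = refl
    partOf-T (wing true) _ ()
    partOf-T (wing false) _ ()
    partOf-T hub true ()
    partOf-T hub false ()

    partOf-L : ∀ k m → partOf k m ≡ pL → k ≡ hub × m ≡ true
    partOf-L hub true _ = refl , refl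
    partOf-L (wing true) _ ()
    partOf-L (wing false) _ ()

    partOf-B : ∀ k m → partOf k m ≡ pB → k ≡ hub × m ≡ false
    partOf-B hub false _ = refl , refl
    partOf-B (wing true) _ ()
    partOf-B (wing false) _ ()

    is-A : ∀ {v} → part v ≡ pA → A v
    is-A = partOf-A _ _

    is-C : ∀ {v} → part v ≡ pC → C v
    is-C = partOf-C _ _

    is-T : ∀ {v} → part v ≡ pT → kind v ≡ free
    is-T = partOf-T _ _

    is-L : ∀ {v} → part v ≡ pL → kind v ≡ hub × Mixed v
    is-L {v} e = let k , m = partOf-L _ _ e in k , does-true⇒ (mixed? v) m

    is-B : ∀ {v} → part v ≡ pB → kind v ≡ hub × (∀ {x} → A x → E v x ≡ true)
    is-B {v} e = let k , m = partOf-B _ _ e in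
      k , λ ax → ≢false⇒true λ vx → does-false⇒ (mixed? v) m (_ , ax , vx)

    in-A : ∀ {v} → A v → part v ≡ pA
    in-A {v} k = cong (λ x → partOf x (does (mixed? v))) k

    in-C : ∀ {v} → C v → part v ≡ pC
    in-C {v} k = cong (λ x → partOf x (does (mixed? v))) k

    two-in : ∀ b → ∃ λ v → ∃ λ w → v ≢ w × kind v ≡ wing b × kind w ≡ wing b
    two-in b =
      let v , kv = wing-point b ; w , kw , vw = wing-edge kv in v , w , Eedge⇒≢ vw , kv , kw

    in-L : ∀ {v} → kind v ≡ hub → Mixed v → part v ≡ pL
    in-L {v} k mv = trans (cong (λ x → partOf x (does (mixed? v))) k)
                          (cong (partOf hub) (dec-true (mixed? v) mv))

    L-nonempty : ∃ λ l → part l ≡ pL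
    L-nonempty with any? (λ s → (kind s ≟ᴷ hub) ×-dec mixed? s)
    ... | yes (s , ks , ms) = s , in-L ks ms
    ... | no none = ⊥-elim (prime (S , (nonempty , uniform) , two , outside))
      where
      S : Subset n
      S v = does (in-wing? true v)
      a₀ = two-in true
      c₀ = wing-point false
      member : ∀ {v} → A v → v ∈ S
      member {v} = dec-true (in-wing? true v)
      nonempty : ∃ λ v → v ∈ S
      nonempty = let v , kv = wing-point true in v , member kv
      two : ∃ λ u → ∃ λ v → u ≢ v × u ∈ S × v ∈ S
      two = let v , w , v≢w , kv , kw = two-in true in v , w , v≢w , member kv , member kw
      outside : ∃ λ v → v ∉ S
      outside = let v , kv = c₀ in v , dec-false (in-wing? true v) λ kv′ →
        contradiction (trans (sym kv) kv′) λ ()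
      uniform : ∀ v → v ∉ S →
        (∀ u → u ∈ S → E v u ≡ true) ⊎ (∀ u → u ∈ S → E v u ≡ false)
      uniform v v∉S = by-kind (kind v) refl
        where
        by-kind : ∀ k → kind v ≡ k →
          (∀ u → u ∈ S → E v u ≡ true) ⊎ (∀ u → u ∈ S → E v u ≡ false)
        by-kind (wing true)  kv = ⊥-elim (does-false⇒ (in-wing? true v) v∉S kv)
        by-kind (wing false) kv = inj₂ λ u u∈S → wing-anti kv (does-true⇒ (in-wing? true u) u∈S)
        by-kind free         kv = inj₂ λ u u∈S → free-wing kv (does-true⇒ (in-wing? true u) u∈S)
        by-kind hub          kv = inj₁ λ u u∈S → ≢false⇒true λ vu →
          none (v , kv , u , does-true⇒ (in-wing? true u) u∈S , vu)

    -- Any `y` in the opposite wing serves for `common-neighbour`: vertices of `L` are mixed on `A`,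
    -- hence complete to `C`. In `B-centre` the wings change roles, as `B` is complete to `A`.
    L-centre : ∃ λ a → part a ≡ pA × (∀ l → part l ≡ pL → E a l ≡ true)
    L-centre =
      let y , ky = wing-point false
          a , ka , h = common-neighbour symE pathFree houseFree
            {λ v → A v} {λ s → kind s ≡ hub × Mixed s}
            (in-wing? true) (λ s → (kind s ≟ᴷ hub) ×-dec mixed? s) y
            (wing-anti ky) (λ (ks , x , kx , sx) → E-swap (mixed⇒complete ks kx sx ky))
            (λ (ku , _) (kv , _) → clique ku kv) (λ (ku , _) → hub-meets true ku)
            (wing-point true)
      in a , in-A ka , λ l pl → h (is-L pl)

    B-centre : ∃ λ c → part c ≡ pC × (∀ b → part b ≡ pB → E c b ≡ true)
    B-centre =
      let y , ky = wing-point true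
          c , kc , h = common-neighbour symE pathFree houseFree
            {λ v → C v} {λ s → part s ≡ pB}
            (in-wing? false) (λ s → part s ≟ᴾB) y
            (wing-anti ky) (λ ps → E-swap (proj₂ (is-B ps) ky))
            (λ pu pv → clique (proj₁ (is-B pu)) (proj₁ (is-B pv)))
            (λ pu → hub-meets false (proj₁ (is-B pu)))
            (wing-point false)
      in c , in-C kc , λ b → h
      where
      _≟ᴾB : ∀ p → Dec (p ≡ pB)
      pA ≟ᴾB = no λ ()
      pB ≟ᴾB = yes refl
      pC ≟ᴾB = no λ ()
      pL ≟ᴾB = no λ ()
      pT ≟ᴾB = no λ ()

    -- `B` is part of a clique, so nothing can be mixed on one of its anticomponents.
    anticomponent-trivial : ∀ {x y} → AntiReach E part x y → x ≡ y × part y ≡ pB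
    anticomponent-trivial (here px) = refl , px
    anticomponent-trivial (step r pz y≢z yz) with anticomponent-trivial r
    ... | refl , py =
      ⊥-elim (true≢false (clique (proj₁ (is-B py)) (proj₁ (is-B pz)) y≢z) yz)

    divide : HasSplitDivide E
    divide = part
      , (let v , w , v≢w , kv , kw = two-in true in v , w , v≢w , in-A kv , in-A kw)
      , (λ a b pa pb → E-swap (proj₂ (is-B pb) (is-A pa)))
      , (λ { a x pa (inj₁ px) → wing-anti (is-A pa) (is-C px)
           ; a x pa (inj₂ px) → E-swap (free-wing (is-T px) (is-A pa)) })
      , L-centre
      , L-nonempty
      , (λ l₁ l₂ p₁ p₂ → clique (proj₁ (is-L p₁)) (proj₁ (is-L p₂)))
      , (λ l pl → let kl , x , kx , lx = is-L pl
                      y , ky , ly = hub-touches kl true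
                  in y , x , in-A ky , in-A kx , ly , lx)
      , L-complete
      , (let v , w , v≢w , kv , kw = two-in false in v , w , v≢w , in-C kv , in-C kw)
      , B-centre
      , (λ c b _ _ (y₁ , y₂ , r₁ , r₂ , cy₁ , cy₂) → true≢false
           (subst (λ y → E c y ≡ true) (sym (proj₁ (anticomponent-trivial r₁))) cy₁)
           (subst (λ y → E c y ≡ false) (sym (proj₁ (anticomponent-trivial r₂))) cy₂))
      , (λ t₁ t₂ p₁ p₂ → free-stable (is-T p₁) (is-T p₂))
      , (λ t c pt pc → free-wing (is-T pt) (is-C pc))
      where
      L-complete : ∀ l x → part l ≡ pL → part x ≡ pB ⊎ part x ≡ pC → E l x ≡ true
      L-complete l x pl (inj₁ px) = clique (proj₁ (is-L pl)) (proj₁ (is-B px)) λ { refl →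
        contradiction (trans (sym pl) px) λ () }
      L-complete l x pl (inj₂ px) =
        let kl , y , ky , ly = is-L pl in mixed⇒complete kl ky ly (is-C px)

  -- Anticomponents of the hub and the order on them

  Anticomponent : Fin n → Set₁
  Anticomponent root = Closure F (λ v → kind v ≡ hub) (λ v → v ≡ root)

  anticomponent : ∀ root → Anticomponent root
  anticomponent root = closure F (λ v → kind v ≟ᴷ hub) (λ v → v ≟ root)

  module InAnticomponent {root : Fin n} (k-root : kind root ≡ hub) (cl : Anticomponent root) where
    open Closure cl public renaming (Z to D; Z? to D?; Z⊆X to D⇒hub)

    root∈D : D root
    root∈D = seed k-root refl

    -- Intersecting `Y` with `D` gives a set closed in the whole hub, to which `least` applies. This
    -- is induction along the nonedges of `D`.
    connected : (Y : Fin n → Set) → Y root → Closed F D Y → D ⊆ Y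
    connected Y y-root closed-Y d = proj₂ (least (λ v → D v × Y v)
      (λ { _ refl → root∈D , y-root })
      (λ hu hv (du , yu) uv → let dv = closed hu hv du uv in dv , closed-Y du dv yu uv) d)

    cross : ∀ {u v} → D u → kind v ≡ hub → ¬ D v → E u v ≡ true
    cross {u} {v} du kv ¬dv = Fnonedge⇒ (λ { refl → ¬dv du })
      (≢true⇒false λ uv → ¬dv (closed (D⇒hub du) kv du uv))

    same-on-wing : ∀ {u v b x} → D u → D v → kind x ≡ wing b → E u x ≡ true → E v x ≡ true
    same-on-wing {b = b} {x} du dv kx ux with bool (E root x)
    ... | inj₁ rx = connected (λ v → E v x ≡ true) rx
      (λ dv dw vx vw → nonadjacent-hubs (D⇒hub dw) (D⇒hub dv) (E-swap (Fedge⇒ vw)) kx vx) dv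
    ... | inj₂ rx = ⊥-elim (true≢false ux (connected (λ v → E v x ≡ false) rx
      (λ dv dw vx vw → ≢true⇒false λ wx → true≢false
        (nonadjacent-hubs (D⇒hub dv) (D⇒hub dw) (Fedge⇒ vw) kx wx) vx) du))

    MixedOn : Fin n → Set
    MixedOn t = ¬ D t × (∃ λ u → D u × E t u ≡ true) × (∃ λ v → D v × E t v ≡ false)

    mixedOn? : Decidable MixedOn
    mixedOn? t = ¬? (D? t) ×-dec any? (λ u → D? u ×-dec (E t u Bool.≟ true))
                           ×-dec any? (λ v → D? v ×-dec (E t v Bool.≟ false))

    -- Hub vertices outside `D` are complete to `D` by `cross`, and a wing vertex sees all of `D` or
    -- nothing by `same-on-wing`.
    mixed-free : ∀ {t} → MixedOn t → kind t ≡ free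
    mixed-free {t} (¬dt , (u , du , tu) , (v , dv , tv)) with kind t in kt
    ... | free   = refl
    ... | hub    = ⊥-elim (true≢false (E-swap (cross dv kt ¬dt)) tv)
    ... | wing b = ⊥-elim (true≢false (E-swap (same-on-wing du dv kt (E-swap tu))) tv)

    mixed-nonedge : ∀ {t} → MixedOn t →
      ∃ λ u → ∃ λ v → D u × D v × E u v ≡ false × E t u ≡ true × E t v ≡ false
    mixed-nonedge {t} (¬dt , (x , dx , tx) , (y , dy , ty))
      with any? (λ u → any? λ v → D? u ×-dec D? v ×-dec (F u v Bool.≟ true)
                   ×-dec (E t u Bool.≟ true) ×-dec (E t v Bool.≟ false))
    ... | yes (u , v , du , dv , uv , tu , tv) = u , v , du , dv , Fedge⇒ uv , tu , tv
    ... | no none with bool (E t root)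
    ...   | inj₁ tr = ⊥-elim (true≢false (connected (λ v → E t v ≡ true) tr
      (λ du dv tu uv → ≢false⇒true λ tv → none (_ , _ , du , dv , uv , tu , tv)) dy) ty)
    ...   | inj₂ tr = ⊥-elim (true≢false tx (connected (λ v → E t v ≡ false) tr
      (λ du dv tu uv → ≢true⇒false λ tv → none (_ , _ , dv , du , F-swap uv , tv , tu)) dx))

    -- Otherwise `w`, `w′`, `t` and a nonedge of `D` split by `t` induce a house, because `D` is
    -- complete to `w` and `w′`.
    mixed-spreads : ∀ {t w w′} → MixedOn t → kind w ≡ hub → kind w′ ≡ hub → ¬ D w → ¬ D w′ →
      E w w′ ≡ false → E t w ≡ true → E t w′ ≡ true
    mixed-spreads {t} {w} {w′} mt kw kw′ ¬dw ¬dw′ ww′ tw = ≢false⇒true λ tw′ →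
      let u , v , du , dv , uv , tu , tv = mixed-nonedge mt
      in houseFree w w′ t v u ww′ (E-swap tw′) tv (E-swap uv)
           (E-swap tw) (E-swap (cross dv kw ¬dw)) (E-swap (cross du kw ¬dw))
           (E-swap (cross dv kw′ ¬dw′)) (E-swap (cross du kw′ ¬dw′)) tu

    -- The targets of the arrows from `D`; the last clause makes the anticomponent of `z`
    -- non-trivial.
    Out : Fin n → Set
    Out z = kind z ≡ hub × ¬ D z × (∃ λ t → MixedOn t × E t z ≡ true) ×
            (∃ λ z′ → kind z′ ≡ hub × z ≢ z′ × E z z′ ≡ false)

    out? : Decidable Out
    out? z = (kind z ≟ᴷ hub) ×-dec ¬? (D? z) ×-dec
      any? (λ t → mixedOn? t ×-dec (E t z Bool.≟ true)) ×-dec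
      any? (λ z′ → (kind z′ ≟ᴷ hub) ×-dec ¬? (z ≟ z′) ×-dec (E z z′ Bool.≟ false))

  module _ {r₁ r₂ : Fin n} (k₁ : kind r₁ ≡ hub) (k₂ : kind r₂ ≡ hub)
           (cl₁ : Anticomponent r₁) (cl₂ : Anticomponent r₂) where
    private
      module D₁ = InAnticomponent k₁ cl₁
      module D₂ = InAnticomponent k₂ cl₂

    -- `mixed-spreads` carries adjacency to `t` along the nonedges of the second anticomponent; so
    -- no vertex is mixed on two of them.
    mixed-uniform : (∀ {v} → D₂.D v → ¬ D₁.D v) → ∀ {t x y} → D₁.MixedOn t →
      D₂.D x → E t x ≡ true → D₂.D y → E t y ≡ true
    mixed-uniform disjoint {t} mt dx tx dy with bool (E t r₂)
    ... | inj₁ tr = D₂.connected (λ v → E t v ≡ true) tr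
      (λ du dv tu uv → D₁.mixed-spreads mt (D₂.D⇒hub du) (D₂.D⇒hub dv) (disjoint du) (disjoint dv)
        (Fedge⇒ uv) tu) dy
    ... | inj₂ tr = ⊥-elim (true≢false tx (D₂.connected (λ v → E t v ≡ false) tr
      (λ du dv tu uv → ≢true⇒false λ tv → true≢false
        (D₁.mixed-spreads mt (D₂.D⇒hub dv) (D₂.D⇒hub du) (disjoint dv) (disjoint du)
          (E-swap (Fedge⇒ uv)) tv) tu) dx))

  -- Passing from an anticomponent to that of a vertex of its Out is a strict partial order.
  module _ {r₁ r₂ : Fin n} (k₁ : kind r₁ ≡ hub) (k₂ : kind r₂ ≡ hub)
           (cl₁ : Anticomponent r₁) (cl₂ : Anticomponent r₂) where
    private
      module D₁ = InAnticomponent k₁ cl₁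
      module D₂ = InAnticomponent k₂ cl₂

    out-decreases : D₁.Out r₂ → D₂.Out ⊆ D₁.Out
    out-decreases (_ , ¬d₁r₂ , (t , mt , tr₂) , _) {z}
                  (kz , ¬d₂z , (t′ , mt′ , t′z) , nonadjacent) =
      kz , ¬d₁z , (t , mt , tz) , nonadjacent
      where
      disjoint : ∀ {v} → D₂.D v → ¬ D₁.D v
      disjoint = D₂.connected (λ v → ¬ D₁.D v) ¬d₁r₂
        λ du dv ¬d₁u uv d₁v → ¬d₁u (D₁.closed (D₂.D⇒hub dv) (D₂.D⇒hub du) d₁v (F-swap uv))
      t-all : ∀ {w} → D₂.D w → E t w ≡ true
      t-all = mixed-uniform k₁ k₂ cl₁ cl₂ disjoint mt D₂.root∈D tr₂
      tt′ : E t t′ ≡ false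
      tt′ = free-stable (D₁.mixed-free mt) (D₂.mixed-free mt′)
      -- No arrow leads back: otherwise `t′` would be complete to the first anticomponent as `t` is
      -- to the second, and a nonedge split by `t`, the vertices `t`, `t′` and a vertex missed by
      -- `t′` would induce a house.
      ¬d₁z : ¬ D₁.D z
      ¬d₁z d₁z =
        let u , v , du , dv , uv , tu , tv = D₁.mixed-nonedge mt
            _ , w′ , _ , dw′ , _ , _ , t′w′ = D₂.mixed-nonedge mt′
            t′-all : ∀ {x} → D₁.D x → E t′ x ≡ true
            t′-all = mixed-uniform k₂ k₁ cl₂ cl₁ (λ d₁ d₂ → disjoint d₂ d₁) mt′ d₁z t′z
        in houseFree u v t t′ w′ uv (E-swap tv) tt′ t′w′
             (E-swap tu) (E-swap (t′-all du)) (D₁.cross du (D₂.D⇒hub dw′) (disjoint dw′))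
             (E-swap (t′-all dv)) (D₁.cross dv (D₂.D⇒hub dw′) (disjoint dw′)) (t-all dw′)
      -- Transitivity: the same `t` witnesses the composite arrow, or a nonedge split by `t′` gives
      -- a house with `t`, `t′`, `z`.
      tz : E t z ≡ true
      tz = ≢false⇒true λ tz →
        let w , w′ , dw , dw′ , ww′ , t′w , t′w′ = D₂.mixed-nonedge mt′
        in houseFree w w′ t′ t z ww′ (E-swap t′w′) (E-swap tt′) tz
             (E-swap t′w) (E-swap (t-all dw)) (D₂.cross dw kz ¬d₂z)
             (E-swap (t-all dw′)) (D₂.cross dw′ kz ¬d₂z) t′z

  record Sink : Set₁ where
    field
      root           : Fin n
      k-root         : kind root ≡ hub
      component      : Anticomponent root
      nonadjacent    : ∃ λ v → kind v ≡ hub × root ≢ v × E root v ≡ false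
      no-out         : ∀ {z} → ¬ InAnticomponent.Out k-root component z

  -- Following an arrow shrinks `Out`, strictly because the target `w` lies in its own anticomponent
  -- and so drops out.
  sink : ∀ {u} → kind u ≡ hub → (∃ λ v → kind v ≡ hub × u ≢ v × E u v ≡ false) → Sink
  sink {u} ku nonadj = descend u ku nonadj (<-wellFounded _)
    where
    descend : ∀ u (ku : kind u ≡ hub) → (∃ λ v → kind v ≡ hub × u ≢ v × E u v ≡ false) →
      Acc _<_ (size (InAnticomponent.out? ku (anticomponent u))) → Sink
    descend u ku nonadj (acc rec) with any? (InAnticomponent.out? ku (anticomponent u))
    ... | no none = record
      { root = u ; k-root = ku ; component = anticomponent u ; nonadjacent = nonadj
      ; no-out = λ out → none (_ , out) }
    ... | yes (w , out@(kw , _ , _ , nonadj′)) =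
      descend w kw nonadj′ (rec (size-< (InAnticomponent.out? kw (anticomponent w))
        (InAnticomponent.out? ku (anticomponent u))
        (out-decreases ku kw (anticomponent u) (anticomponent w) out) out
        λ (_ , ¬d , _) → ¬d (InAnticomponent.root∈D kw (anticomponent w))))

  -- The divide of the complement at a sink

  module SinkDivide (s : Sink) where
    open Sink s
    open InAnticomponent k-root component

    Complete Anti : Fin n → Set
    Complete v = ∀ {u} → D u → E v u ≡ true
    Anti v = ∀ {u} → D u → E v u ≡ false

    -- In the complement `L` must be complete to `C`, so vertices complete to `D` that have a
    -- neighbour mixed on `D` are moved to `T`.
    data Role (v : Fin n) : Part → Set where
      in-A : D v → Role v pA
      in-L : MixedOn v → Role v pL
      in-B : ¬ D v → Anti v → Role v pB
      in-T : ¬ D v → Complete v → (∃ λ t → MixedOn t × E t v ≡ true) → Role v pT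
      in-C : ¬ D v → Complete v → (∀ {t} → MixedOn t → E t v ≡ false) → Role v pC

    role : ∀ v → ∃ (Role v)
    role v with D? v
    ... | yes dv = pA , in-A dv
    ... | no ¬dv with any? (λ u → D? u ×-dec (E v u Bool.≟ true))
    ...   | no ¬nbr = pB , in-B ¬dv λ du → ≢true⇒false λ vu → ¬nbr (_ , du , vu)
    ...   | yes nbr with any? (λ u → D? u ×-dec (E v u Bool.≟ false))
    ...     | yes non = pL , in-L (¬dv , nbr , non)
    ...     | no ¬non with any? (λ t → mixedOn? t ×-dec (E t v Bool.≟ true))
    ...       | yes t = pT , in-T ¬dv (λ du → ≢false⇒true λ vu → ¬non (_ , du , vu)) t
    ...       | no ¬t = pC , in-C ¬dv (λ du → ≢false⇒true λ vu → ¬non (_ , du , vu))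
                                  (λ mt → ≢true⇒false λ tv → ¬t (_ , mt , tv))

    part : Fin n → Part
    part v = proj₁ (role v)

    as : ∀ {v p} → part v ≡ p → Role v p
    as {v} refl = proj₂ (role v)

    A⇒D : ∀ {v} → part v ≡ pA → D v
    A⇒D pv with in-A dv ← as pv = dv

    D⇒A : ∀ {v} → D v → part v ≡ pA
    D⇒A {v} dv with role v
    ... | _ , in-A _         = refl
    ... | _ , in-L (¬dv , _) = contradiction dv ¬dv
    ... | _ , in-B ¬dv _     = contradiction dv ¬dv
    ... | _ , in-T ¬dv _ _   = contradiction dv ¬dv
    ... | _ , in-C ¬dv _ _   = contradiction dv ¬dv

    L⇒mixed : ∀ {v} → part v ≡ pL → MixedOn v
    L⇒mixed pv with in-L mv ← as pv = mv

    mixed⇒L : ∀ {v} → MixedOn v → part v ≡ pL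
    mixed⇒L {v} mv@(¬dv , (x , dx , vx) , (y , dy , vy)) with role v
    ... | _ , in-A dv     = contradiction dv ¬dv
    ... | _ , in-L _      = refl
    ... | _ , in-B _ anti = ⊥-elim (true≢false vx (anti dx))
    ... | _ , in-T _ c _  = ⊥-elim (true≢false (c dy) vy)
    ... | _ , in-C _ c _  = ⊥-elim (true≢false (c dy) vy)

    complete⇒C : ∀ {v} → ¬ D v → Complete v → (∀ {t} → MixedOn t → E t v ≡ false) → part v ≡ pC
    complete⇒C {v} ¬dv c no-t with role v
    ... | _ , in-A dv                      = contradiction dv ¬dv
    ... | _ , in-L (_ , _ , (y , dy , vy)) = ⊥-elim (true≢false (c dy) vy)
    ... | _ , in-B _ anti                  = ⊥-elim (true≢false (c root∈D) (anti root∈D))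
    ... | _ , in-T _ _ (t , mt , tv)       = ⊥-elim (true≢false tv (no-t mt))
    ... | _ , in-C _ _ _                   = refl

    wing-outside : ∀ {v b} → kind v ≡ wing b → ¬ D v
    wing-outside kv dv = contradiction (trans (sym kv) (D⇒hub dv)) λ ()

    -- `root` misses vertices of at most one wing, and all of `D` agrees with `root` on the wings.
    -- The wing found supplies two vertices of `C`, the one complete to `B` in the complement, and
    -- the auxiliary vertex in `A-centre`.
    complete-wing : ∃ λ b → ∀ {v} → kind v ≡ wing b → Complete v
    complete-wing with any? (λ x → in-wing? true x ×-dec (E root x Bool.≟ false))
    ... | yes (x , kx , rx) = false , λ kv du →
      E-swap (same-on-wing root∈D du kv (mixed⇒complete k-root kx rx kv))
    ... | no none = true , λ kv du →
      E-swap (same-on-wing root∈D du kv (≢false⇒true λ rv → none (_ , kv , rv)))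

    full : Bool
    full = proj₁ complete-wing

    full⇒C : ∀ {v} → kind v ≡ wing full → part v ≡ pC
    full⇒C kv = complete⇒C (wing-outside kv) (proj₂ complete-wing kv)
                            (λ mt → free-wing (mixed-free mt) kv)

    -- Having no neighbour in `D`, the vertex `b` is neither in the hub nor in the full wing; it is
    -- free or in the other wing.
    full-anti-B : ∀ {y b} → kind y ≡ wing full → part b ≡ pB → F y b ≡ true
    full-anti-B {y} {b} ky pb with as pb
    ... | in-B ¬db anti = Fedge y≢b (yb (kind b) refl)
      where
      y≢b : y ≢ b
      y≢b refl = contradiction (trans (sym (full⇒C ky)) pb) λ ()
      yb : ∀ k → kind b ≡ k → E y b ≡ false
      yb hub      kb = ⊥-elim (true≢false (E-swap (cross root∈D kb ¬db)) (anti root∈D))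
      yb free     kb = E-swap (free-wing kb ky)
      yb (wing c) kb with c Bool.≟ full
      ... | yes refl = ⊥-elim (true≢false (proj₂ complete-wing kb root∈D) (anti root∈D))
      ... | no c≢full with Bool.¬-not c≢full
      ...   | refl = wing-anti ky kb

    partner : ∃ λ v → D v × root ≢ v
    partner = let v , kv , root≢v , e = nonadjacent in
      v , closed k-root kv root∈D (Fedge root≢v e) , root≢v

    L-nonempty : ∃ λ l → part l ≡ pL
    L-nonempty with any? mixedOn?
    ... | yes (t , mt) = t , mixed⇒L mt
    ... | no none = ⊥-elim (prime ((λ v → does (D? v)) , (nonempty , uniform) , two , outside))
      where
      nonempty : ∃ λ v → does (D? v) ≡ true
      nonempty = root , dec-true (D? root) root∈D
      two : ∃ λ u → ∃ λ v → u ≢ v × does (D? u) ≡ true × does (D? v) ≡ true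
      two = let v , dv , root≢v = partner in
        root , v , root≢v , dec-true (D? root) root∈D , dec-true (D? v) dv
      outside : ∃ λ v → does (D? v) ≡ false
      outside = let v , kv = wing-point true in v , dec-false (D? v) (wing-outside kv)
      uniform : ∀ v → does (D? v) ≡ false →
        (∀ u → does (D? u) ≡ true → E v u ≡ true) ⊎ (∀ u → does (D? u) ≡ true → E v u ≡ false)
      uniform v out with role v
      ... | _ , in-A dv     = ⊥-elim (does-false⇒ (D? v) out dv)
      ... | _ , in-L mv     = ⊥-elim (none (v , mv))
      ... | _ , in-B _ anti = inj₂ λ u du → anti (does-true⇒ (D? u) du)
      ... | _ , in-T _ c _  = inj₁ λ u du → c (does-true⇒ (D? u) du)
      ... | _ , in-C _ c _  = inj₁ λ u du → c (does-true⇒ (D? u) du)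

    mixed-clique : ∀ {t t′} → MixedOn t → MixedOn t′ → t ≢ t′ → F t t′ ≡ true
    mixed-clique mt mt′ t≢t′ = Fedge t≢t′ (free-stable (mixed-free mt) (mixed-free mt′))

    -- `D` is connected in the complement, so one vertex `y` missed by `t` suffices. As `connected`
    -- only leads away from `root`, the decidable `Reached.Z` stands in for `Y`: were `root` outside
    -- it, so would be `y`.
    mixed-meets : ∀ {t} → MixedOn t → Meets F D t
    mixed-meets {t} (¬dt , _ , (y , dy , ty)) Y seed-Y closed-Y dx =
      Reached.least Y seed-Y closed-Y (all-reached dx)
      where
      module Reached = Closure (closure F {D} {λ v → F t v ≡ true} D? (λ v → F t v Bool.≟ true))
      all-reached : D ⊆ Reached.Z
      all-reached dx with Reached.Z? root
      ... | yes zr = connected Reached.Z zr Reached.closed dx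
      ... | no ¬zr = ⊥-elim (connected (λ v → ¬ Reached.Z v) ¬zr
        (λ du dv ¬zu uv zv → ¬zu (Reached.closed dv du zv (F-swap uv))) dy
        (Reached.seed dy (Fedge (λ { refl → ¬dt dy }) ty)))

    A-centre : ∃ λ a → part a ≡ pA × (∀ l → part l ≡ pL → F a l ≡ true)
    A-centre =
      let y , ky = wing-point full
          a , da , h = common-neighbour symF pathFree-F houseFree-F {D} {MixedOn} D? mixedOn? y
            (λ dx → Fnonedge (proj₂ complete-wing ky dx))
            (λ {t} mt → F-swap (Fedge
              (λ { refl → contradiction (trans (sym ky) (mixed-free mt)) λ () })
              (free-wing (mixed-free mt) ky)))
            mixed-clique mixed-meets (root , root∈D)
      in a , D⇒A da , λ l pl → h (L⇒mixed pl)

    L-complete : ∀ l x → part l ≡ pL → part x ≡ pB ⊎ part x ≡ pC → F l x ≡ true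
    L-complete l x pl (inj₂ px) with as px
    ... | in-C _ _ no-t = Fedge (λ { refl → contradiction (trans (sym pl) px) λ () }) (no-t (L⇒mixed pl))
    L-complete l x pl (inj₁ px) with as px
    ... | in-B ¬dx anti = Fedge (λ { refl → contradiction (trans (sym pl) px) λ () }) (lx (kind x) refl)
      where
      kl : kind l ≡ free
      kl = mixed-free (L⇒mixed pl)
      lx : ∀ k → kind x ≡ k → E l x ≡ false
      lx hub      kx = ⊥-elim (true≢false (E-swap (cross root∈D kx ¬dx)) (anti root∈D))
      lx free     kx = free-stable kl kx
      lx (wing _) kx = free-wing kl kx

    -- Otherwise `t`, `u`, `c`, `y`, `z` is an induced P₅, with `t` mixed on `D` and `u` its
    -- neighbour in `D`. Edges of G inside `B` are the steps within an anticomponent of `B` in the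
    -- complement.
    B-uniform : ∀ {c y z} → part c ≡ pC → part y ≡ pB → part z ≡ pB → E y z ≡ true →
      E c y ≡ true → E c z ≡ true
    B-uniform {c} {y} {z} pc py pz yz cy with as pc | as py | as pz | L-nonempty
    ... | in-C _ c-complete no-t | in-B _ y-anti | in-B _ z-anti | t , pt =
      let mt = L⇒mixed pt
          _ , (u , du , tu) , _ = mt
          toB : ∀ {x} → part x ≡ pB → E t x ≡ false
          toB {x} px = Fedge⇒ (L-complete t x pt (inj₁ px))
      in ≢false⇒true λ cz →
        pathFree t u c y z tu (E-swap (c-complete du)) cy yz (no-t mt) (toB py) (toB pz)
          (E-swap (y-anti du)) (E-swap (z-anti du)) cz

    reach : ∀ {c b y} → part c ≡ pC → AntiReach F part b y →
      part y ≡ pB × (E c b ≡ true → E c y ≡ true) × (E c y ≡ true → E c b ≡ true)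
    reach pc (here pb) = pb , (λ e → e) , (λ e → e)
    reach {c} pc (step r pz y≢z yz) =
      let py , to , from = reach pc r
          yz′ = Fnonedge⇒ y≢z yz
      in pz , (λ e → B-uniform pc py pz yz′ (to e)) , λ e → from (B-uniform pc pz py (E-swap yz′) e)

    T-hub : ∀ {v} → part v ≡ pT → kind v ≡ hub
    T-hub {v} pv with as pv
    ... | in-T _ _ (t , mt , tv) = of-kind (kind v) refl
      where
      of-kind : ∀ k → kind v ≡ k → kind v ≡ hub
      of-kind hub      kv = kv
      of-kind free     kv = ⊥-elim (true≢false tv (free-stable (mixed-free mt) kv))
      of-kind (wing _) kv = ⊥-elim (true≢false tv (free-wing (mixed-free mt) kv))

    -- Here the sink is used: a nonadjacent `w` would put `v` into `Out`.
    T-hub-complete : ∀ {v w} → part v ≡ pT → kind w ≡ hub → v ≢ w → E v w ≡ true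
    T-hub-complete {v} pv kw v≢w with as pv
    ... | in-T ¬dv _ t = ≢false⇒true λ vw → no-out (T-hub pv , ¬dv , t , _ , kw , v≢w , vw)

    T-stable : ∀ t₁ t₂ → part t₁ ≡ pT → part t₂ ≡ pT → F t₁ t₂ ≡ false
    T-stable t₁ t₂ p₁ p₂ with t₁ ≟ t₂
    ... | yes refl  = irrF t₁
    ... | no t₁≢t₂ = Fnonedge (T-hub-complete p₁ (T-hub p₂) t₁≢t₂)

    -- If `w` and `c` were nonadjacent in G, they would form a house with `t` and a nonedge of `D`
    -- split by `t`.
    T-anti-C : ∀ w c → part w ≡ pT → part c ≡ pC → F w c ≡ false
    T-anti-C w c pw pc with as pw | as pc
    ... | in-T _ w-complete (t , mt , tw) | in-C _ c-complete no-t =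
      Fnonedge (≢false⇒true λ wc →
        let u , v , du , dv , uv , tu , tv = mixed-nonedge mt
        in houseFree w c t v u wc (E-swap (no-t mt)) tv (E-swap uv)
             (E-swap tw) (w-complete dv) (w-complete du) (c-complete dv) (c-complete du) tu)

    divide : HasSplitDivide F
    divide = part
      , (let v , dv , root≢v = partner in root , v , root≢v , D⇒A root∈D , D⇒A dv)
      , A-B
      , A-CT
      , A-centre
      , L-nonempty
      , (λ l₁ l₂ p₁ p₂ → mixed-clique (L⇒mixed p₁) (L⇒mixed p₂))
      , L-mixed
      , L-complete
      , (let v , kv = wing-point full ; w , kw , vw = wing-edge kv
         in v , w , Eedge⇒≢ vw , full⇒C kv , full⇒C kw)
      , (let v , kv = wing-point full in v , full⇒C kv , λ b → full-anti-B kv)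
      , B-not-mixed
      , T-stable
      , T-anti-C
      where
      B-not-mixed : ∀ c b → part c ≡ pC → part b ≡ pB → ¬ MixedOnAnticomponent F part c b
      B-not-mixed c b pc pb (y₁ , y₂ , r₁ , r₂ , cy₁ , cy₂) =
        let p₁ , to , _ = reach pc r₁
            p₂ , _ , from = reach pc r₂
            c≢y₂ : c ≢ y₂
            c≢y₂ = λ { refl → contradiction (trans (sym pc) p₂) λ () }
        in true≢false cy₁ (Fnonedge (to (from (Fnonedge⇒ c≢y₂ cy₂))))
      A-B : ∀ a b → part a ≡ pA → part b ≡ pB → F a b ≡ true
      A-B a b pa pb with as pb
      ... | in-B ¬db anti = Fedge (λ { refl → ¬db (A⇒D pa) }) (E-swap (anti (A⇒D pa)))
      A-CT : ∀ a x → part a ≡ pA → part x ≡ pC ⊎ part x ≡ pT → F a x ≡ false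
      A-CT a x pa (inj₁ px) with as px
      ... | in-C _ c _ = Fnonedge (E-swap (c (A⇒D pa)))
      A-CT a x pa (inj₂ px) with as px
      ... | in-T _ c _ = Fnonedge (E-swap (c (A⇒D pa)))
      L-mixed : ∀ l → part l ≡ pL → ∃ λ a₁ → ∃ λ a₂ →
        part a₁ ≡ pA × part a₂ ≡ pA × F l a₁ ≡ true × F l a₂ ≡ false
      L-mixed l pl =
        let ¬dl , (x , dx , lx) , (y , dy , ly) = L⇒mixed pl
        in y , x , D⇒A dy , D⇒A dx , Fedge (λ l≡y → ¬dl (subst D (sym l≡y) dy)) ly , Fnonedge lx

module _ {n} {E F : Adj n} (adm : Admissible E F) where
  open Admissible adm

  framed-divide : Frame E → HasSplitDivide E ⊎ HasSplitDivide F
  framed-divide frame-E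
    with any? (λ u → any? λ v → (kind u ≟ᴷ hub) ×-dec (kind v ≟ᴷ hub) ×-dec ¬? (u ≟ v)
                 ×-dec (E u v Bool.≟ false))
    where open Frame frame-E
  ... | yes (u , v , ku , kv , u≢v , uv) =
    inj₂ (SinkDivide.divide adm frame-E (sink adm frame-E ku (v , kv , u≢v , uv)))
  ... | no none = inj₁ (CliqueHub.divide adm frame-E
    λ ku kv u≢v → ≢false⇒true λ uv → none (_ , _ , ku , kv , u≢v , uv))

-- Obstructions to being split

TwoK2 : ∀ {n} → Adj n → Set
TwoK2 {n} E = ∃ λ (a : Fin n) → ∃ λ b → ∃ λ c → ∃ λ d → E a b ≡ true × E c d ≡ true ×
  E a c ≡ false × E a d ≡ false × E b c ≡ false × E b d ≡ false

FourCycle : ∀ {n} → Adj n → Set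
FourCycle {n} E = ∃ λ (a : Fin n) → ∃ λ b → ∃ λ c → ∃ λ d → a ≢ c × b ≢ d ×
  E a b ≡ true × E b c ≡ true × E c d ≡ true × E a d ≡ true × E a c ≡ false × E b d ≡ false

twoK2-separation : ∀ {n} {E : Adj n} → Symmetric E → TwoK2 E → ∃ (Separation E)
twoK2-separation {n} {E} symE (a , b , c , d , ab , cd , ac , ad , bc , bd) =
  label , record { point = point ; edge = edge ; anti = anti }
  where
  swap : ∀ {u v x} → E u v ≡ x → E v u ≡ x
  swap {u} {v} = trans (symE v u)
  AB CD : Fin n → Set
  AB v = v ≡ a ⊎ v ≡ b
  CD v = v ≡ c ⊎ v ≡ d
  AB? : Decidable AB
  AB? v = (v ≟ a) ⊎-dec (v ≟ b)
  CD? : Decidable CD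
  CD? v = (v ≟ c) ⊎-dec (v ≟ d)
  disjoint : ∀ {v} → AB v → ¬ CD v
  disjoint (inj₁ refl) (inj₁ refl) = true≢false cd ad
  disjoint (inj₁ refl) (inj₂ refl) = true≢false (swap cd) ac
  disjoint (inj₂ refl) (inj₁ refl) = true≢false cd bd
  disjoint (inj₂ refl) (inj₂ refl) = true≢false (swap cd) bc
  pick : {A B : Set} → Dec A → Dec B → Maybe Bool
  pick d e = if does d then just true else if does e then just false else nothing
  pick-first : {A B : Set} (d : Dec A) (e : Dec B) → pick d e ≡ just true → A
  pick-first (yes x) _       _ = x
  pick-first (no _)  (yes _) ()
  pick-first (no _)  (no _)  ()
  pick-second : {A B : Set} (d : Dec A) (e : Dec B) → pick d e ≡ just false → B
  pick-second (no _)  (yes y) _ = y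
  pick-second (yes _) _       ()
  pick-second (no _)  (no _)  ()
  label : Fin n → Maybe Bool
  label v = pick (AB? v) (CD? v)
  in-AB : ∀ {v} → AB v → label v ≡ just true
  in-AB {v} h rewrite dec-true (AB? v) h = refl
  in-CD : ∀ {v} → CD v → label v ≡ just false
  in-CD {v} h rewrite dec-false (AB? v) (λ h′ → disjoint h′ h) | dec-true (CD? v) h = refl
  is-AB : ∀ {v} → label v ≡ just true → AB v
  is-AB {v} = pick-first (AB? v) (CD? v)
  is-CD : ∀ {v} → label v ≡ just false → CD v
  is-CD {v} = pick-second (AB? v) (CD? v)
  point : ∀ x → ∃ λ v → label v ≡ just x
  point true  = a , in-AB (inj₁ refl)
  point false = c , in-CD (inj₁ refl)
  edge : ∀ {x v} → label v ≡ just x → ∃ λ w → label w ≡ just x × E v w ≡ true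
  edge {true} {v} lv with is-AB {v} lv
  ... | inj₁ refl = b , in-AB (inj₂ refl) , ab
  ... | inj₂ refl = a , in-AB (inj₁ refl) , swap ab
  edge {false} {v} lv with is-CD {v} lv
  ... | inj₁ refl = d , in-CD (inj₂ refl) , cd
  ... | inj₂ refl = c , in-CD (inj₁ refl) , swap cd
  nonedge : ∀ {v w} → AB v → CD w → E v w ≡ false
  nonedge (inj₁ refl) (inj₁ refl) = ac
  nonedge (inj₁ refl) (inj₂ refl) = ad
  nonedge (inj₂ refl) (inj₁ refl) = bc
  nonedge (inj₂ refl) (inj₂ refl) = bd
  anti : ∀ {x v w} → label v ≡ just x → label w ≡ just (not x) → E v w ≡ false
  anti {true}  {v} {w} lv lw = nonedge (is-AB {v} lv) (is-CD {w} lw)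
  anti {false} {v} {w} lv lw = swap (nonedge (is-AB {w} lw) (is-CD {v} lv))

twoK2-divide : ∀ {n} {E F : Adj n} → Admissible E F → TwoK2 E → HasSplitDivide E ⊎ HasSplitDivide F
twoK2-divide adm t =
  let label , sep = twoK2-separation symE t in framed-divide adm (frame symE irrE label sep)
  where open Admissible adm

-- The Földes–Hammer theorem.  A clique K is improved until its complement is stable; the total
-- weight of K, each vertex counting n + 1 plus its degree, increases in each step.
module _ {n} {E : Adj n} (symE : Symmetric E) (irrE : Irreflexive E) (cycleFree : CycleFree E) where

  private
    swap : ∀ {u v x} → E u v ≡ x → E v u ≡ x
    swap {u} {v} = trans (symE v u)

    neighbour? : ∀ v → Decidable (λ u → E v u ≡ true)
    neighbour? v u = E v u Bool.≟ true

    -- The summand n + 1 exceeds every degree, so two vertices always outweigh one; the degree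
    -- decides exchanges of one vertex for another.
    weight : Fin n → ℕ
    weight v = suc n + size (neighbour? v)

    Clique : (Fin n → Set) → Set
    Clique K = ∀ {u v} → K u → K v → u ≢ v → E u v ≡ true

    outside : {K : Fin n → Set} → Decidable K → ℕ
    outside K? = weigh weight (λ v → ¬? (K? v))

    Obstruction : Set
    Obstruction = TwoK2 E ⊎ FourCycle E

    weight< : ∀ k x y → weight k < weight x + weight y
    weight< k x y = begin-strict
      suc n + size (neighbour? k) ≤⟨ +-monoʳ-≤ (suc n) (size≤ (neighbour? k)) ⟩
      suc n + n                   <⟨ +-monoʳ-< (suc n) ≤-refl ⟩
      suc n + suc n               ≤⟨ +-mono-≤ (m≤m+n (suc n) _) (m≤m+n (suc n) _) ⟩
      weight x + weight y         ∎
      where open ≤-Reasoning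

    Add : (Fin n → Set) → Fin n → Fin n → Set
    Add K x v = v ≡ x ⊎ K v

    add? : {K : Fin n → Set} → Decidable K → ∀ x → Decidable (Add K x)
    add? K? x v = (v ≟ x) ⊎-dec K? v

    Del : (Fin n → Set) → Fin n → Fin n → Set
    Del K k v = v ≢ k × K v

    del? : {K : Fin n → Set} → Decidable K → ∀ k → Decidable (Del K k)
    del? K? k v = ¬? (v ≟ k) ×-dec K? v

    outside-add : {K : Fin n → Set} (K? : Decidable K) → ∀ {x} → ¬ K x →
                  weight x + outside (add? K? x) ≤ outside K?
    outside-add K? {x} ¬kx = weigh-insert weight (λ v → ¬? (add? K? x v)) (λ v → ¬? (K? v))
      (_∘ inj₂) ¬kx λ h → h (inj₁ refl)

    outside-del : {K : Fin n → Set} (K? : Decidable K) → ∀ k →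
                  outside (del? K? k) ≤ weight k + outside K?
    outside-del {K} K? k = weigh-remove weight (λ v → ¬? (K? v)) (λ v → ¬? (del? K? k v)) k sub
      where
      sub : ∀ {v} → ¬ Del K k v → v ≡ k ⊎ ¬ K v
      sub {v} h with v ≟ k
      ... | yes v≡k = inj₁ v≡k
      ... | no  v≢k = inj₂ λ kv → h (v≢k , kv)

    add-clique : ∀ {K x} → Clique K → (∀ {v} → K v → E x v ≡ true) → Clique (Add K x)
    add-clique clique h (inj₁ refl) (inj₁ refl) u≢v = contradiction refl u≢v
    add-clique clique h (inj₁ refl) (inj₂ kv)   _   = h kv
    add-clique clique h (inj₂ ku)   (inj₁ refl) _   = swap (h ku)
    add-clique clique h (inj₂ ku)   (inj₂ kv)   u≢v = clique ku kv u≢v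

    del-clique : ∀ {K k} → Clique K → Clique (Del K k)
    del-clique clique (_ , ku) (_ , kv) = clique ku kv

    CompleteBut : (Fin n → Set) → Fin n → Fin n → Set
    CompleteBut K k x = ∀ {v} → Del K k v → E x v ≡ true

    Better : {K : Fin n → Set} → Decidable K → Set₁
    Better K? = ∃ λ (K′ : Fin n → Set) → ∃ λ (K′? : Decidable K′) →
      Clique K′ × outside K′? < outside K?

    -- If N(k) lies in N(x), then `x` has larger degree, because of `y`, and replaces `k`. Otherwise
    -- a neighbour `z` of `k` missed by `x` leads to a 2K₂, a C₄ or an excluded C₅.
    exchange : {K : Fin n → Set} (K? : Decidable K) → Clique K → ∀ {x y k b} →
      ¬ K x → ¬ K y → K k → K b → b ≢ k → E x y ≡ true → E x k ≡ false → E y k ≡ false →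
      E y b ≡ false → CompleteBut K k x → Better K? ⊎ Obstruction
    exchange {K} K? clique {x} {y} {k} {b} ¬kx ¬ky kk kb b≢k xy xk yk yb complete
      with any? (λ z → neighbour? k z ×-dec (E x z Bool.≟ false))
    ... | no none = inj₁ (Add (Del K k) x , add? (del? K? k) x ,
        add-clique (del-clique clique) complete , smaller)
      where
      degree< : size (neighbour? k) < size (neighbour? x)
      degree< = size-< (neighbour? k) (neighbour? x)
        (λ kz → ≢false⇒true λ xz → none (_ , kz , xz)) xy (λ ky → true≢false (swap ky) yk)
      smaller : outside (add? (del? K? k) x) < outside K?
      smaller = +-cancelˡ-< (weight x) _ _ (begin-strict
        weight x + outside (add? (del? K? k) x) ≤⟨ outside-add (del? K? k) (¬kx ∘ proj₂) ⟩
        outside (del? K? k)                     ≤⟨ outside-del K? k ⟩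
        weight k + outside K?                   <⟨ +-monoˡ-< (outside K?) (+-monoʳ-< (suc n) degree<) ⟩
        weight x + outside K?                   ∎)
        where open ≤-Reasoning
    ... | yes (z , kz , xz) with bool (E y z) | bool (E z b)
    ...   | inj₂ yz | _ = inj₂ (inj₁ (x , y , k , z , xy , kz , xk , xz , yk , yz))
    ...   | inj₁ yz | inj₁ zb = inj₂ (inj₂ (z , y , x , b ,
        (λ { refl → true≢false (swap kz) xk }) , (λ { refl → ¬ky kb }) ,
        swap yz , swap xy , complete (b≢k , kb) , zb , swap xz , yb))
    ...   | inj₁ yz | inj₂ zb = ⊥-elim (cycleFree k z y x b kz (swap yz) (swap xy)
        (complete (b≢k , kb)) (clique kk kb (b≢k ∘ sym)) (swap yk) (swap xk) (swap xz) zb yb)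

    -- If `k` is the only vertex of `K` missed by `x` and by `y`, both replace it; if this holds for
    -- just one of them, `exchange` applies; otherwise further missed vertices `a` and `b` give an
    -- obstruction.
    improve-at : {K : Fin n → Set} (K? : Decidable K) → Clique K → ∀ {x y k} →
      ¬ K x → ¬ K y → K k → E x y ≡ true → E x k ≡ false → E y k ≡ false → Better K? ⊎ Obstruction
    improve-at {K} K? clique {x} {y} {k} ¬kx ¬ky kk xy xk yk
      with any? (λ v → del? K? k v ×-dec (E x v Bool.≟ false))
         | any? (λ v → del? K? k v ×-dec (E y v Bool.≟ false))
    ... | no x-complete | yes (b , (b≢k , kb) , yb) =
      exchange K? clique ¬kx ¬ky kk kb b≢k xy xk yk yb
        λ dv → ≢false⇒true λ xv → x-complete (_ , dv , xv)
    ... | yes (a , (a≢k , ka) , xa) | no y-complete =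
      exchange K? clique ¬ky ¬kx kk ka a≢k (swap xy) yk xk xa
        λ dv → ≢false⇒true λ yv → y-complete (_ , dv , yv)
    ... | no x-complete | no y-complete = inj₁ (Add (Add (Del K k) y) x ,
        add? (add? (del? K? k) y) x ,
        add-clique (add-clique (del-clique clique)
            (λ dv → ≢false⇒true λ yv → y-complete (_ , dv , yv)))
          [ (λ { refl → xy }) , (λ dv → ≢false⇒true λ xv → x-complete (_ , dv , xv)) ] , smaller)
      where
      K₁? = add? (del? K? k) y
      K₂? = add? K₁? x
      smaller : outside K₂? < outside K?
      smaller = +-cancelˡ-< (weight x + weight y) _ _ (begin-strict
        weight x + weight y + outside K₂?   ≡⟨ cong (_+ outside K₂?) (+-comm (weight x) (weight y)) ⟩
        weight y + weight x + outside K₂?   ≡⟨ +-assoc (weight y) _ _ ⟩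
        weight y + (weight x + outside K₂?) ≤⟨ +-monoʳ-≤ (weight y) (outside-add K₁?
                                                [ (λ { refl → true≢false xy (irrE x) }) , ¬kx ∘ proj₂ ]) ⟩
        weight y + outside K₁?              ≤⟨ outside-add (del? K? k) (¬ky ∘ proj₂) ⟩
        outside (del? K? k)                 ≤⟨ outside-del K? k ⟩
        weight k + outside K?               <⟨ +-monoˡ-< (outside K?) (weight< k x y) ⟩
        weight x + weight y + outside K?    ∎)
        where open ≤-Reasoning
    ... | yes (a , (a≢k , ka) , xa) | yes (b , (b≢k , kb) , yb) with bool (E y a) | bool (E x b)
    ...   | inj₂ ya | _ =
      inj₂ (inj₁ (x , y , k , a , xy , clique kk ka (a≢k ∘ sym) , xk , xa , yk , ya))
    ...   | _ | inj₂ xb =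
      inj₂ (inj₁ (x , y , k , b , xy , clique kk kb (b≢k ∘ sym) , xk , xb , yk , yb))
    ...   | inj₁ ya | inj₁ xb = inj₂ (inj₂ (x , y , a , b ,
        (λ { refl → ¬kx ka }) , (λ { refl → ¬ky kb }) , xy , ya ,
        clique ka kb (λ { refl → true≢false xb xa }) , xb , xa , yb))

    add-vertex : {K : Fin n → Set} (K? : Decidable K) → Clique K → ∀ {x} → ¬ K x →
      ¬ (∃ λ v → K v × E x v ≡ false) → Better K?
    add-vertex {K} K? clique {x} ¬kx none = Add K x , add? K? x ,
      add-clique clique (λ kv → ≢false⇒true λ xv → none (_ , kv , xv)) ,
      ≤-trans (s≤s (m≤n+m _ _)) (outside-add K? ¬kx)

    improve : {K : Fin n → Set} (K? : Decidable K) → Clique K → ∀ {x y} →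
      ¬ K x → ¬ K y → E x y ≡ true → Better K? ⊎ Obstruction
    improve {K} K? clique {x} {y} ¬kx ¬ky xy
      with any? (λ v → K? v ×-dec (E x v Bool.≟ false)) | any? (λ v → K? v ×-dec (E y v Bool.≟ false))
    ... | no none | _ = inj₁ (add-vertex K? clique ¬kx none)
    ... | _ | no none = inj₁ (add-vertex K? clique ¬ky none)
    ... | yes (k , kk , xk) | yes (l , kl , yl) with bool (E y k) | bool (E x l)
    ...   | inj₂ yk | _ = improve-at K? clique ¬kx ¬ky kk xy xk yk
    ...   | _ | inj₂ xl = improve-at K? clique ¬kx ¬ky kl xy xl yl
    ...   | inj₁ yk | inj₁ xl = inj₂ (inj₂ (x , y , k , l ,
        (λ { refl → ¬kx kk }) , (λ { refl → ¬ky kl }) , xy , yk ,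
        clique kk kl (λ { refl → true≢false yk yl }) , xl , xk , yl))

    search : {K : Fin n → Set} (K? : Decidable K) → Clique K → Acc _<_ (outside K?) →
      IsSplit E ⊎ Obstruction
    search K? clique (acc rec)
      with any? (λ x → any? λ y → ¬? (K? x) ×-dec ¬? (K? y) ×-dec (E x y Bool.≟ true))
    ... | no none = inj₁ ((λ v → does (K? v)) ,
        (λ u v ku kv → clique (does-true⇒ (K? u) ku) (does-true⇒ (K? v) kv)) ,
        (λ u v ku kv → ≢true⇒false λ uv →
          none (u , v , does-false⇒ (K? u) ku , does-false⇒ (K? v) kv , uv)))
    ... | yes (x , y , ¬kx , ¬ky , xy) with improve K? clique ¬kx ¬ky xy
    ...   | inj₁ (_ , K′? , clique′ , smaller) = search K′? clique′ (rec smaller)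
    ...   | inj₂ o = inj₂ o

  split-or-obstruction : IsSplit E ⊎ TwoK2 E ⊎ FourCycle E
  split-or-obstruction = search {λ _ → ⊥} (λ _ → no λ ()) (λ ()) (<-wellFounded _)

-- The two diagonals of the cycle become the two edges.
fourCycle⇒twoK2 : ∀ {n} {E F : Adj n} → Complementary E F → FourCycle E → TwoK2 F
fourCycle⇒twoK2 c (x , y , z , t , x≢z , y≢t , xy , yz , zt , xt , xz , yt) =
  x , z , y , t , Fedge x≢z xz , Fedge y≢t yt ,
  Fnonedge xy , Fnonedge xt , Fnonedge (E-swap yz) , Fnonedge zt
  where open Complementary c

theorem3p1 : (n : ℕ) (E : Adj n) → Symmetric E → Irreflexive E →
    Prime E →
    ¬ ContainsInduced E P5 → ¬ ContainsInduced E coP5 → ¬ ContainsInduced E C5 →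
    IsSplit E ⊎ HasSplitDivide E ⊎ HasSplitDivide (compl E)
theorem3p1 n E symE irrE prime noP5 noCoP5 noC5 =
  Sum.map₂ [ twoK2-divide adm , Sum.swap ∘ twoK2-divide (flip-free adm) ∘ fourCycle⇒twoK2 compl-E ]
    (split-or-obstruction symE irrE (Admissible.cycleFree adm))
  where
  compl-E : Complementary E (compl E)
  compl-E = compl-complementary symE irrE
  adm : Admissible E (compl E)
  adm = record { complementary = compl-E ; prime = prime
               ; noP5 = noP5 ; noCoP5 = noCoP5 ; noC5 = noC5 }
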